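{- Let $q$ be a prime power, $n\ge2$, let $r_1,r_2$ be positive divisors of $n$, and let $\alpha\in\mathbb{F}_{q^n}^*$. Consider in $\mathrm{PG}(1,q^n)$ \[L_{r_1}=\{\langle (x,\mathrm{Tr}_{q^n/q^{r_1}}(x))\rangle_{\mathbb{F}_{q^n}}\colon x\in\mathbb{F}_{q^n}^*\},\qquad \sigma(L_{r_2})=\{\langle (\alpha\,\mathrm{Tr}_{q^n/q^{r_2}}(y),y)\rangle_{\mathbb{F}_{q^n}}\colon y\in\mathbb{F}_{q^n}^*\}.\] If $\frac n2\ge r_1+r_2+1$, then $L_{r_1}\cap\sigma(L_{r_2})\neq\emptyset$.
   Context: For a divisor $r$ of $n$, $\mathrm{Tr}_{q^n/q^r}(x)=\sum_{i=0}^{n/r-1}x^{q^{ir}}$. $\sigma$ denotes the projectivity $\langle (X_0,X_1)\rangle_{\mathbb{F}_{q^n}}\mapsto\langle(X_1,X_0)\rangle_{\mathbb{F}_{q^n}}$ of $\mathrm{PG}(1,q^n)$. -}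

module Defs where

open import Level using (Level; _⊔_; suc)
open import Algebra.Bundles using (CommutativeRing)
open import Data.Fin.Base using (Fin; toℕ)
open import Data.Fin.Properties using (≡-setoid)
open import Data.Nat.Base as ℕ using (ℕ; NonZero)
open import Data.Nat.DivMod using (_/_)
open import Data.Nat.Primality using (Prime)
open import Data.Product.Base using (_×_; _,_; proj₁; proj₂; ∃-syntax; Σ-syntax)
open import Function.Base using (_∘_)
open import Function.Bundles using (Inverse)
open import Relation.Binary.Core using (Rel)
open import Relation.Binary.PropositionalEquality.Core using (_≡_)
open import Relation.Nullary.Negation.Core using (¬_)
open import Relation.Unary using (Pred)
import Algebra.Definitions
import Algebra.Properties.Semiring.Exp
import Algebra.Properties.Semiring.Sum

IsPrimePower : ℕ → Set
IsPrimePower q = ∃[ p ] ∃[ k ] Prime p × 1 ℕ.≤ k × q ≡ p ℕ.^ k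

-- Since a finite field is determined up to isomorphism by its order, 𝔽_N is
-- an arbitrary field whose carrier setoid is in bijection with Fin N.
record FiniteField (c ℓ : Level) (N : ℕ) : Set (suc (c ⊔ ℓ)) where
  field
    commutativeRing : CommutativeRing c ℓ
  open CommutativeRing commutativeRing public
  open Algebra.Definitions _≈_ using (Invertible)
  field
    1≉0         : 1# ≉ 0#
    invertible  : ∀ x → x ≉ 0# → Invertible 1# _*_ x
    enumeration : Inverse setoid (≡-setoid N)

module ProjectiveLine {c ℓ N} (F : FiniteField c ℓ N) where
  open FiniteField F

  -- A point of PG(1,N) is represented by a nonzero vector spanning it;
  -- equality of points is _≋_, not propositional equality.
  record Point : Set (c ⊔ ℓ) where
    constructor ⟨_,_⟩[_]
    field
      X₀ X₁   : Carrier
      nonzero : ¬ (X₀ ≈ 0# × X₁ ≈ 0#)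
  open Point public

  infix 4 _≋_
  _≋_ : Rel Point (c ⊔ ℓ)
  P ≋ Q = ∃[ l ] l ≉ 0# × X₀ P ≈ l * X₀ Q × X₁ P ≈ l * X₁ Q

module LinearSets (q n : ℕ) {c ℓ} (F : FiniteField c ℓ (q ℕ.^ n)) where
  open FiniteField F
  open Algebra.Properties.Semiring.Exp semiring using (_^_)
  open Algebra.Properties.Semiring.Sum semiring using (sum)
  open ProjectiveLine F

  -- Tr r is the trace from 𝔽_{q^n} to 𝔽_{q^r}; meaningful when r divides n.
  Tr : (r : ℕ) .{{_ : NonZero r}} → Carrier → Carrier
  Tr r x = sum {n / r} λ i → x ^ (q ℕ.^ (toℕ i ℕ.* r))

  L : (r : ℕ) .{{_ : NonZero r}} → Pred Point (c ⊔ ℓ)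
  L r P = ∃[ x ] Σ[ x≉0 ∈ x ≉ 0# ] P ≋ ⟨ x , Tr r x ⟩[ x≉0 ∘ proj₁ ]

  -- The image under σ : ⟨(X₀,X₁)⟩ ↦ ⟨(X₁,X₀)⟩ of {⟨(y, α Tr(y))⟩ : y ≠ 0}.
  σL : (α : Carrier) (r : ℕ) .{{_ : NonZero r}} → Pred Point (c ⊔ ℓ)
  σL α r P = ∃[ y ] Σ[ y≉0 ∈ y ≉ 0# ] P ≋ ⟨ α * Tr r y , y ⟩[ y≉0 ∘ proj₂ ]

{-# OPTIONS --safe #-}

-- A common point exists as soon as Tr₁(x) = 1 and Tr₂(y) = 1 for some x y = α.  Let p be the prime
-- dividing q, write qⁿ = pˢ, and let pᴿⁱ be the order of the subfield onto which Trᵢ maps.  The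
-- indicator function of {Trᵢ = 1} is the polynomial Pᵢ = 1 − (Trᵢ − 1)^(pᴿⁱ − 1), whose exponents,
-- written in base p, have digit sum at most Rᵢ(p − 1).  If there is no such pair (x, y), then
-- P₁(x) P₂(α/x) vanishes for x ≠ 0, so all its coefficients modulo x^(pˢ − 1) − 1 are zero.  But, as
-- s ≥ 2(R₁ + R₂ + 1), there are exponents e₁ of P₁ and e₂ of P₂ of maximal digit sum whose digits are
-- so sparse that any other f₁ − f₂ ≡ e₁ − e₂ (mod pˢ − 1) involves carries and hence a larger digit
-- sum.  So x^(e₁ − e₂) arises only once, and its coefficient, a product of multinomial coefficients
-- prime to p and a power of α, is nonzero.
module Submission where

open import Defs
open import Level using (_⊔_)
open import Algebra.Bundles using (CommutativeMonoid)
open import Data.Nat.Base as ℕ using (ℕ; zero; suc; NonZero; z≤n; s≤s)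
import Data.Nat.Properties as ℕ
open import Data.Nat.Combinatorics using (_C_; nCk+nC[k+1]≡[n+1]C[k+1]; nC1≡n; nCn≡1)
open import Data.Nat.Combinatorics.Specification using (k>n⇒nCk≡0)
open import Data.Nat.Coprimality using (prime⇒coprime; coprime-Bézout)
open import Data.Nat.Divisibility using (_∣_; divides; quotient; ∣n⇒∣m*n; ∣m⇒∣m*n; ∣⇒≤; m%n≡0⇒n∣m)
open import Data.Nat.DivMod using (_%_; _/_; m≡m%n+[m/n]*n; m%n<n; m*n/n≡m; [m+kn]%n≡m%n; m<n⇒m%n≡m)
import Data.Nat.GCD as GCD
open import Data.Nat.Primality using (Prime; euclidsLemma; prime⇒nonZero; prime⇒nonTrivial; prime⇒irreducible)
open import Data.Nat.Tactic.RingSolver using (solve-∀)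
open import Data.Fin.Base using (Fin; zero; suc; toℕ; punchIn; inject≤; fromℕ<; inject₁; fromℕ)
import Data.Fin.Properties as Fin
open import Data.Product.Base using (_×_; _,_; proj₁; proj₂; ∃-syntax; Σ-syntax)
open import Data.Sum.Base using (_⊎_; inj₁; inj₂)
open import Data.Unit.Base using (⊤; tt)
open import Data.Vec.Base using (Vec; []; _∷_; replicate)
open import Function.Base using (_∘_; const; id; it)
open import Function.Bundles using (Inverse)
import Function.Construct.Composition as Composition
import Function.Construct.Symmetry as Symmetry
open import Relation.Binary.PropositionalEquality as ≡ using (_≡_; _≢_; cong; cong₂; subst)
open import Relation.Nullary using (¬_; Dec; yes; no; contradiction)
open import Relation.Nullary.Decidable using (map′; ¬?; _×-dec_)
open import Relation.Unary using (_∩_; Satisfiable)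
import Algebra.Properties.CommutativeMonoid.Sum
import Algebra.Properties.CommutativeSemigroup
import Algebra.Properties.CommutativeSemiring.Binomial
import Algebra.Properties.CommutativeSemiring.Exp
import Algebra.Properties.Ring
import Algebra.Properties.Semiring.Mult
import Algebra.Properties.Semiring.Sum
import Relation.Binary.Reasoning.Setoid

-- That carries cost digit sum is a potential argument. If at every position at most one of `e₁`,
-- `e₂` is nonzero and `2 (e₁ + e₂) ≤ p − 1`, then a carry `c` in and `c′` out satisfy
-- `e₁ + e₂ + |c′| ≤ f₁ + f₂ + |c|`. Around the cycle of `s` positions the carries cancel, and as
-- the digit sums of the `fᵢ` do not exceed those of the `eᵢ`, every step is tight. Tightness still
-- permits a negative carry that starts at a digit of `e₂` and is absorbed by a digit of `e₁` just
-- above; hence `e₁` is placed below `e₂` and the top positions stay empty. The positions congruent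
-- modulo `Rᵢ` must have digit sum `p − 1` in `eᵢ`, because the power in `Pᵢ` is a product of
-- `(p − 1)`-st powers, one for each residue class. For odd `p` this means two digits `(p − 1)/2`
-- per class, a stretch of `2 Rᵢ` positions; the two positions left free at the top account for the
-- rest of the bound. For `p = 2` a digit 1 violates `2 (e₁ + e₂) ≤ p − 1`; the ones are then kept
-- apart, and the potential is lowered by `ω` right after each of them.

module Binomials where
  open import Data.Nat.Base using (_+_; _*_; _≤_; _<_)
  open ≡.≡-Reasoning

  absorption : ∀ n k → suc k * (suc n C suc k) ≡ suc n * (n C k)
  absorption zero zero = ≡.refl
  absorption zero (suc k) = begin
    suc (suc k) * (1 C suc (suc k))  ≡⟨ cong (suc (suc k) *_) (k>n⇒nCk≡0 {1} {suc (suc k)} (s≤s (s≤s z≤n))) ⟩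
    suc (suc k) * 0  ≡⟨ ℕ.*-zeroʳ (suc (suc k)) ⟩
    0  ∎
  absorption (suc n) zero = begin
    1 * (suc (suc n) C 1)  ≡⟨ ℕ.*-identityˡ (suc (suc n) C 1) ⟩
    suc (suc n) C 1  ≡⟨ nC1≡n (suc (suc n)) ⟩
    suc (suc n)  ≡⟨ ℕ.*-identityʳ (suc (suc n)) ⟨
    suc (suc n) * 1  ∎
  absorption (suc n) (suc k) = begin
    suc (suc k) * (suc (suc n) C suc (suc k))
      ≡⟨ cong (suc (suc k) *_) (nCk+nC[k+1]≡[n+1]C[k+1] (suc n) (suc k)) ⟨
    suc (suc k) * (a + (suc n C suc (suc k)))
      ≡⟨ ℕ.*-distribˡ-+ (suc (suc k)) a _ ⟩
    suc (suc k) * a + suc (suc k) * (suc n C suc (suc k))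
      ≡⟨ cong (suc (suc k) * a +_) (absorption n (suc k)) ⟩
    a + suc k * a + suc n * (n C suc k)
      ≡⟨ cong (λ z → a + z + suc n * (n C suc k)) (absorption n k) ⟩
    a + suc n * (n C k) + suc n * (n C suc k)
      ≡⟨ ℕ.+-assoc a _ _ ⟩
    a + (suc n * (n C k) + suc n * (n C suc k))
      ≡⟨ cong (a +_) (ℕ.*-distribˡ-+ (suc n) (n C k) (n C suc k)) ⟨
    a + suc n * (n C k + n C suc k)
      ≡⟨ cong (λ z → a + suc n * z) (nCk+nC[k+1]≡[n+1]C[k+1] n k) ⟩
    suc (suc n) * a  ∎
    where a = suc n C suc k

  -- Absorption makes the prime divide `suc k` times the coefficient, and `suc k` is smaller than
  -- the prime.
  prime∣C : ∀ {n k} → Prime (suc n) → k < n → suc n ∣ (suc n C suc k)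
  prime∣C {n} {k} pr k<n
    with euclidsLemma (suc k) (suc n C suc k) pr (subst (suc n ∣_) (≡.sym (absorption n k)) (∣m⇒∣m*n (n C k) (divides 1 (≡.sym (ℕ.*-identityˡ _)))))
  ... | inj₁ d = contradiction (∣⇒≤ d) (ℕ.<⇒≱ (s≤s k<n))
  ... | inj₂ d = d

  -- Absorption lowers `n` and `k` together, and each factor `suc n` met on the way is below `p`.
  prime∤C : ∀ {p} → Prime p → ∀ n k → k ≤ n → n < p → ¬ p ∣ (n C k)
  prime∤C pr n zero _ n<p d = contradiction (∣⇒≤ d) (ℕ.<⇒≱ (ℕ.nonTrivial⇒n>1 _ {{prime⇒nonTrivial pr}}))
  prime∤C {p} pr (suc n) (suc k) (s≤s k≤n) n<p d
    with euclidsLemma (suc n) (n C k) pr (subst (p ∣_) (absorption n k) (∣n⇒∣m*n (suc k) d))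
  ... | inj₁ e = contradiction (∣⇒≤ e) (ℕ.<⇒≱ n<p)
  ... | inj₂ e = prime∤C pr n k k≤n (ℕ.<-trans (ℕ.n<1+n n) n<p) e

-- Finite fields: sums and products over all elements

module FieldTheory {c ℓ N} (F : FiniteField c ℓ N) where
  open FiniteField F public hiding (zero)
  open Algebra.Properties.Ring ring public using (-‿distribˡ-*; -‿distribʳ-*; +-cancelˡ; +-cancelʳ)
  open Algebra.Properties.CommutativeSemiring.Exp commutativeSemiring public
  open Algebra.Properties.Semiring.Mult semiring public renaming (_×_ to _⊗_)
  open Algebra.Properties.Semiring.Sum semiring public
  open Relation.Binary.Reasoning.Setoid setoid

  index : Carrier → Fin N
  index = Inverse.to enumeration

  element : Fin N → Carrier
  element = Inverse.from enumeration

  element-index : ∀ x → element (index x) ≈ x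
  element-index = Inverse.strictlyInverseʳ enumeration

  index-injective : ∀ {x y} → index x ≡ index y → x ≈ y
  index-injective {x} {y} eq = trans (sym (element-index x)) (trans (reflexive (cong element eq)) (element-index y))

  element-injective : ∀ {i j} → element i ≈ element j → i ≡ j
  element-injective {i} {j} eq = ≡.trans (≡.sym (Inverse.strictlyInverseˡ enumeration i))
    (≡.trans (Inverse.to-cong enumeration eq) (Inverse.strictlyInverseˡ enumeration j))

  infix 4 _≟_
  _≟_ : ∀ x y → Dec (x ≈ y)
  x ≟ y = map′ index-injective (Inverse.to-cong enumeration) (index x Fin.≟ index y)

  search : ∀ {a} {P : Carrier → Set a} → (∀ {x y} → x ≈ y → P x → P y) →
           (∀ x → Dec (P x)) → Dec (∃[ x ] P x)
  search {P = P} resp P? = map′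
    (λ (i , Pi) → element i , Pi)
    (λ (x , Px) → index x , resp (sym (element-index x)) Px)
    (Fin.any? (P? ∘ element))

  integral : ∀ {x y} → x ≉ 0# → x * y ≈ 0# → y ≈ 0#
  integral {x} {y} x≉0 xy≈0 with invertible x x≉0
  ... | x⁻¹ , x⁻¹x≈1 , _ = begin
    y              ≈⟨ *-identityˡ y ⟨
    1# * y         ≈⟨ *-congʳ x⁻¹x≈1 ⟨
    x⁻¹ * x * y    ≈⟨ *-assoc _ _ _ ⟩
    x⁻¹ * (x * y)  ≈⟨ *-congˡ xy≈0 ⟩
    x⁻¹ * 0#       ≈⟨ zeroʳ x⁻¹ ⟩
    0#             ∎

  *-≉0 : ∀ {x y} → x ≉ 0# → y ≉ 0# → x * y ≉ 0#
  *-≉0 x≉0 y≉0 = y≉0 ∘ integral x≉0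

  ^-≉0 : ∀ {x} n → x ≉ 0# → x ^ n ≉ 0#
  ^-≉0 zero    x≉0 = 1≉0
  ^-≉0 (suc n) x≉0 = *-≉0 x≉0 (^-≉0 n x≉0)

  *-cancel : ∀ {x y z} → x ≉ 0# → x * y ≈ x * z → y ≈ z
  *-cancel {x} {y} {z} x≉0 eq = +-cancelʳ (- z) y z (trans (integral x≉0 (begin
    x * (y - z)          ≈⟨ distribˡ x y (- z) ⟩
    x * y + x * (- z)    ≈⟨ +-cong eq (sym (-‿distribʳ-* x z)) ⟩
    x * z - x * z        ≈⟨ -‿inverseʳ _ ⟩
    0#                   ∎)) (sym (-‿inverseʳ z)))

  0^ : ∀ n .{{_ : NonZero n}} → 0# ^ n ≈ 0#
  0^ (suc n) = zeroˡ _

  1^ : ∀ n → 1# ^ n ≈ 1#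
  1^ zero    = refl
  1^ (suc n) = trans (*-identityˡ _) (1^ n)

  module Total {m ℓm} (M : CommutativeMonoid m ℓm) where
    private module M = CommutativeMonoid M
    private module Big = Algebra.Properties.CommutativeMonoid.Sum M

    total : (Carrier → M.Carrier) → M.Carrier
    total f = Big.sum (f ∘ element)

    total-cong : ∀ {f g} → (∀ x → f x M.≈ g x) → total f M.≈ total g
    total-cong f≈g = Big.sum-cong-≋ (f≈g ∘ element)

    total-∙ : ∀ f g → total (λ x → f x M.∙ g x) M.≈ total f M.∙ total g
    total-∙ f g = Big.∑-distrib-+ (f ∘ element) (g ∘ element)

    total-permute : ∀ {f} → (∀ {x y} → x ≈ y → f x M.≈ f y) → (π : Inverse setoid setoid) →
                    total (f ∘ Inverse.to π) M.≈ total f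
    total-permute {f} f-cong π = M.sym (M.trans (Big.sum-permute (f ∘ element) perm)
      (Big.sum-cong-≋ λ i → f-cong (element-index (Inverse.to π (element i)))))
      where
      perm : Inverse (≡.setoid (Fin N)) (≡.setoid (Fin N))
      perm = Composition.inverse (Composition.inverse (Symmetry.inverse enumeration) π) enumeration

    sum-single : ∀ {n} (f : Fin n → M.Carrier) i → (∀ j → j ≢ i → f j M.≈ M.ε) → Big.sum f M.≈ f i
    sum-single {suc n} f i f≈ε = M.trans (Big.sum-remove {i = i} f) (M.trans
      (M.∙-congˡ (M.trans (Big.sum-cong-≋ (λ j → f≈ε (punchIn i j) (Fin.punchInᵢ≢i i j))) (Big.sum-replicate-zero n)))
      (M.identityʳ _))

    total-single : ∀ {f} → (∀ {x y} → x ≈ y → f x M.≈ f y) →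
                   ∀ a → (∀ x → x ≉ a → f x M.≈ M.ε) → total f M.≈ f a
    total-single {f} f-cong a f≈ε = M.trans
      (sum-single (f ∘ element) (index a)
        (λ j j≢ → f≈ε (element j) (λ eq → j≢ (element-injective (trans eq (sym (element-index a)))))))
      (f-cong (element-index a))

  open Total +-commutativeMonoid public
    renaming (total to ∑all; total-cong to ∑all-cong; total-∙ to ∑all-+; total-permute to ∑all-permute; total-single to ∑all-single)
    hiding (sum-single)
  open Total *-commutativeMonoid public
    renaming (total to ∏all; total-cong to ∏all-cong; total-∙ to ∏all-*; total-permute to ∏all-permute; total-single to ∏all-single)
    hiding (sum-single)
  open Algebra.Properties.CommutativeMonoid.Sum *-commutativeMonoid public using ()
    renaming (sum-replicate to product-replicate)

  ∑all-scale : ∀ a f → a * ∑all f ≈ ∑all (λ x → a * f x)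
  ∑all-scale a f = *-distribˡ-sum a (f ∘ element)

  translation : Inverse setoid setoid
  translation = record
    { to = _+ 1# ; from = _- 1#
    ; to-cong = +-congʳ ; from-cong = +-congʳ
    ; inverse = (λ eq → trans (+-congʳ eq) (cancel (-‿inverseˡ 1#)))
              , (λ eq → trans (+-congʳ eq) (cancel (-‿inverseʳ 1#)))
    }
    where
    cancel : ∀ {x y z} → y + z ≈ 0# → x + y + z ≈ x
    cancel yz≈0 = trans (+-assoc _ _ _) (trans (+-congˡ yz≈0) (+-identityʳ _))

  scaling : ∀ {a} → a ≉ 0# → Inverse setoid setoid
  scaling {a} a≉0 with invertible a a≉0
  ... | a⁻¹ , a⁻¹a≈1 , aa⁻¹≈1 = record
    { to = a *_ ; from = a⁻¹ *_
    ; to-cong = *-congˡ ; from-cong = *-congˡ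
    ; inverse = (λ eq → trans (*-congˡ eq) (cancel aa⁻¹≈1))
              , (λ eq → trans (*-congˡ eq) (cancel a⁻¹a≈1))
    }
    where
    cancel : ∀ {x y z} → x * y ≈ 1# → x * (y * z) ≈ z
    cancel xy≈1 = trans (sym (*-assoc _ _ _)) (trans (*-congʳ xy≈1) (*-identityˡ _))

  scaling-to : ∀ {a} (a≉0 : a ≉ 0#) x → Inverse.to (scaling a≉0) x ≡ a * x
  scaling-to {a} a≉0 x with invertible a a≉0
  ... | _ , _ , _ = ≡.refl

  -- The translation `x ↦ x + 1` permutes the terms of the sum of all elements, yet adds `N` ones to
  -- it.
  card⊗1≈0 : N ⊗ 1# ≈ 0#
  card⊗1≈0 = +-cancelˡ (∑all id) (N ⊗ 1#) 0# (begin
    ∑all id + N ⊗ 1#         ≈⟨ +-congˡ (sum-replicate N) ⟨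
    ∑all id + ∑all (λ _ → 1#) ≈⟨ ∑all-+ id (λ _ → 1#) ⟨
    ∑all (_+ 1#)             ≈⟨ ∑all-permute id translation ⟩
    ∑all id                  ≈⟨ +-identityʳ _ ⟨
    ∑all id + 0#             ∎)

  private
    choose : Carrier → Carrier → Carrier → Carrier
    choose u v x with x ≟ 0#
    ... | yes _ = u
    ... | no  _ = v

    choose-yes : ∀ u v {x} → x ≈ 0# → choose u v x ≡ u
    choose-yes u v {x} x≈0 with x ≟ 0#
    ... | yes _ = ≡.refl
    ... | no x≉0 = contradiction x≈0 x≉0

    choose-no : ∀ u v {x} → x ≉ 0# → choose u v x ≡ v
    choose-no u v {x} x≉0 with x ≟ 0#
    ... | yes x≈0 = contradiction x≈0 x≉0
    ... | no _ = ≡.refl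

    choose-cong : ∀ u v {x y} → x ≈ y → choose u v x ≡ choose u v y
    choose-cong u v {x} {y} x≈y with x ≟ 0#
    ... | yes x≈0 = ≡.sym (choose-yes u v (trans (sym x≈y) x≈0))
    ... | no  x≉0 = ≡.sym (choose-no u v (λ y≈0 → x≉0 (trans x≈y y≈0)))

  ∏all-≉0 : ∀ {f} → (∀ x → f x ≉ 0#) → ∏all f ≉ 0#
  ∏all-≉0 {f} f≉0 = go (f ∘ element) (f≉0 ∘ element)
    where
    open Algebra.Properties.CommutativeMonoid.Sum *-commutativeMonoid using () renaming (sum to product)
    go : ∀ {n} (g : Fin n → Carrier) → (∀ i → g i ≉ 0#) → product g ≉ 0#
    go {zero}  g g≉0 = 1≉0
    go {suc n} g g≉0 = *-≉0 (g≉0 zero) (go (g ∘ suc) (g≉0 ∘ suc))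

  -- Scaling by a nonzero `a` permutes the nonzero elements. To keep all products over the whole
  -- field, `φ` replaces 0 by 1, and the factor `a` that the scaling does not contribute at 0 is
  -- split off as `δ`.
  fermat : ∀ a → a ^ N ≈ a
  fermat a with a ≟ 0#
  ... | yes a≈0 = trans (^-congˡ N a≈0) (trans (0^N N ≡.refl) (sym a≈0))
    where
    0^N : ∀ n → n ≡ N → 0# ^ n ≈ 0#
    0^N (suc n) _ = zeroˡ _
    0^N zero ≡.refl with index 0#
    ... | ()
  ... | no a≉0 = begin
    a ^ N                          ≈⟨ product-replicate N ⟨
    ∏all (λ _ → a)                 ≈⟨ ∏all-cong split ⟩
    ∏all (λ x → ψ x * δ x)         ≈⟨ ∏all-* ψ δ ⟩
    ∏all ψ * ∏all δ                ≈⟨ *-cong ∏ψ≈1 ∏δ≈a ⟩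
    1# * a                         ≈⟨ *-identityˡ a ⟩
    a                              ∎
    where
    φ ψ δ : Carrier → Carrier
    φ x = x + choose 1# 0# x
    ψ = choose 1# a
    δ = choose a 1#

    split : ∀ x → a ≈ ψ x * δ x
    split x with x ≟ 0#
    ... | yes _ = sym (*-identityˡ a)
    ... | no  _ = sym (*-identityʳ a)

    φ-0 : ∀ {x} → x ≈ 0# → φ x ≈ 1#
    φ-0 {x} x≈0 = trans (+-cong x≈0 (reflexive (choose-yes 1# 0# x≈0))) (+-identityˡ 1#)

    φ-≉0 : ∀ {x} → x ≉ 0# → φ x ≈ x
    φ-≉0 {x} x≉0 = trans (+-congˡ (reflexive (choose-no 1# 0# x≉0))) (+-identityʳ x)

    φ≉0 : ∀ x → φ x ≉ 0#
    φ≉0 x with x ≟ 0#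
    ... | yes x≈0 = λ eq → 1≉0 (trans (sym (trans (+-congʳ x≈0) (+-identityˡ 1#))) eq)
    ... | no  x≉0 = λ eq → x≉0 (trans (sym (+-identityʳ x)) eq)

    φ-scale : ∀ x → φ (a * x) ≈ ψ x * φ x
    φ-scale x with x ≟ 0#
    ... | yes x≈0 = trans (φ-0 (trans (*-congˡ x≈0) (zeroʳ a)))
                      (sym (trans (*-identityˡ _) (trans (+-congʳ x≈0) (+-identityˡ 1#))))
    ... | no  x≉0 = trans (φ-≉0 (*-≉0 a≉0 x≉0)) (*-congˡ (sym (+-identityʳ x)))

    ∏ψ≈1 : ∏all ψ ≈ 1#
    ∏ψ≈1 = *-cancel (∏all-≉0 φ≉0) (begin
      ∏all φ * ∏all ψ         ≈⟨ *-comm _ _ ⟩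
      ∏all ψ * ∏all φ         ≈⟨ ∏all-* ψ φ ⟨
      ∏all (λ x → ψ x * φ x)  ≈⟨ ∏all-cong (λ x → trans (sym (φ-scale x)) (reflexive (cong φ (≡.sym (scaling-to a≉0 x))))) ⟩
      ∏all (φ ∘ Inverse.to (scaling a≉0)) ≈⟨ ∏all-permute (λ eq → +-cong eq (reflexive (choose-cong 1# 0# eq))) (scaling a≉0) ⟩
      ∏all φ                  ≈⟨ *-identityʳ _ ⟨
      ∏all φ * 1#             ∎)

    ∏δ≈a : ∏all δ ≈ a
    ∏δ≈a = trans (∏all-single (λ eq → reflexive (choose-cong a 1# eq)) 0# (λ x x≉0 → reflexive (choose-no a 1# x≉0)))
      (reflexive (choose-yes a 1# refl))

  -- Monic polynomials and their roots

  -- A vector of length d stands for the monic polynomial of degree d with these lower coefficients.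
  ⟦_⟧ : ∀ {d} → Vec Carrier d → Carrier → Carrier
  ⟦ [] ⟧     x = 1#
  ⟦ b ∷ bs ⟧ x = b + x * ⟦ bs ⟧ x

  synthetic-division : ∀ {d} (bs : Vec Carrier (suc d)) a →
    Σ[ ds ∈ Vec Carrier d ] ∀ x → ⟦ bs ⟧ x ≈ (x - a) * ⟦ ds ⟧ x + ⟦ bs ⟧ a
  synthetic-division (b ∷ []) a = [] , λ x → sym (begin
    (x - a) * 1# + (b + a * 1#)  ≈⟨ +-cong (*-identityʳ _) (+-comm _ _) ⟩
    x - a + (a * 1# + b)         ≈⟨ +-congˡ (+-congʳ (*-identityʳ a)) ⟩
    x - a + (a + b)              ≈⟨ +-assoc _ _ _ ⟩
    x + (- a + (a + b))          ≈⟨ +-congˡ (+-assoc _ _ _) ⟨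
    x + (- a + a + b)            ≈⟨ +-congˡ (trans (+-congʳ (-‿inverseˡ a)) (+-identityˡ b)) ⟩
    x + b                        ≈⟨ +-comm x b ⟩
    b + x                        ≈⟨ +-congˡ (*-identityʳ x) ⟨
    b + x * 1#                   ∎)
  synthetic-division (b ∷ bs@(_ ∷ _)) a with synthetic-division bs a
  -- As in Horner's scheme, the lowest coefficient of the quotient is the value at `a` of the
  -- polynomial stripped of its constant term and divided by `x`.
  ... | ds , eq = ⟦ bs ⟧ a ∷ ds , λ x → let P = ⟦ bs ⟧ a; Q = ⟦ ds ⟧ x in begin
    b + x * ⟦ bs ⟧ x                       ≈⟨ +-congˡ (*-congˡ (eq x)) ⟩
    b + x * ((x - a) * Q + P)              ≈⟨ +-congˡ (distribˡ x _ P) ⟩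
    b + (x * ((x - a) * Q) + x * P)        ≈⟨ +-congˡ (+-congʳ (trans (sym (*-assoc _ _ _)) (trans (*-congʳ (*-comm _ _)) (*-assoc _ _ _)))) ⟩
    b + ((x - a) * (x * Q) + x * P)        ≈⟨ +-congˡ (+-congˡ (*-congʳ (sym (trans (+-assoc _ _ _) (trans (+-congˡ (-‿inverseˡ a)) (+-identityʳ x)))))) ⟩
    b + ((x - a) * (x * Q) + (x - a + a) * P)  ≈⟨ +-congˡ (+-congˡ (distribʳ P _ _)) ⟩
    b + ((x - a) * (x * Q) + ((x - a) * P + a * P))  ≈⟨ +-congˡ (trans (sym (+-assoc _ _ _)) (+-congʳ (trans (+-comm _ _) (sym (distribˡ _ _ _))))) ⟩
    b + ((x - a) * (P + x * Q) + a * P)    ≈⟨ +-assoc _ _ _ ⟨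
    b + (x - a) * (P + x * Q) + a * P      ≈⟨ +-congʳ (+-comm _ _) ⟩
    (x - a) * (P + x * Q) + b + a * P      ≈⟨ +-assoc _ _ _ ⟩
    (x - a) * (P + x * Q) + (b + a * P)    ∎

  x-y≈0⇒x≈y : ∀ {x y} → x - y ≈ 0# → x ≈ y
  x-y≈0⇒x≈y {x} {y} eq = +-cancelʳ (- y) x y (trans eq (sym (-‿inverseʳ y)))

  -- The quotient by `x − a zero` has degree one less and vanishes at the remaining points; in
  -- degree 0 only the constant 1 is left, which has no root.
  root-bound : ∀ {d} (bs : Vec Carrier d) (a : Fin (suc d) → Carrier) →
    (∀ i j → a i ≈ a j → i ≡ j) → ¬ (∀ i → ⟦ bs ⟧ (a i) ≈ 0#)
  root-bound [] a inj roots = 1≉0 (roots zero)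
  root-bound {suc d} bs a inj roots with synthetic-division bs (a zero)
  ... | ds , eq = root-bound ds (a ∘ suc) (λ i j e → Fin.suc-injective (inj (suc i) (suc j) e)) λ i →
    integral (λ e → contradiction (inj (suc i) zero (x-y≈0⇒x≈y e)) λ ())
      (trans (sym (trans (eq (a (suc i))) (trans (+-congˡ (roots zero)) (+-identityʳ _)))) (roots (suc i)))

  -- Applied to X (X^r − 1), which vanishes on the whole field.
  nonroot-of-unity : ∀ r → 2 ℕ.+ r ℕ.< N → ¬ (∀ x → x ≉ 0# → x ^ suc r ≈ 1#)
  nonroot-of-unity r r< unity = root-bound (0# ∷ - 1# ∷ replicate r 0#) (λ i → element (inject≤ i r<))
    (λ i j e → Fin.inject≤-injective r< r< i j (element-injective e)) (λ i → vanish (element (inject≤ i r<)))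
    where
    monomial : ∀ n x → ⟦ replicate n 0# ⟧ x ≈ x ^ n
    monomial zero    x = refl
    monomial (suc n) x = trans (+-identityˡ _) (*-congˡ (monomial n x))

    vanish : ∀ x → 0# + x * (- 1# + x * ⟦ replicate r 0# ⟧ x) ≈ 0#
    vanish x with x ≟ 0#
    ... | yes x≈0 = trans (+-identityˡ _) (trans (*-congʳ x≈0) (zeroˡ _))
    ... | no  x≉0 = trans (+-identityˡ _) (trans (*-congˡ (trans (+-congˡ (trans (*-congˡ (monomial r x)) (unity x x≉0))) (-‿inverseˡ 1#))) (zeroʳ x))

  -- Power sums

  fermat′ : ∀ {a} → a ≉ 0# → a ^ ℕ.pred N ≈ 1#
  fermat′ {a} a≉0 = go N ≡.refl
    where
    go : ∀ n → n ≡ N → a ^ ℕ.pred n ≈ 1#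
    go zero    _  = refl
    go (suc n) eq = *-cancel a≉0 (trans (trans (reflexive (cong (a ^_) eq)) (fermat a)) (sym (*-identityʳ a)))

  fermat-multiple : ∀ {a} → a ≉ 0# → ∀ k → a ^ (k ℕ.* ℕ.pred N) ≈ 1#
  fermat-multiple {a} a≉0 k = begin
    a ^ (k ℕ.* ℕ.pred N)   ≈⟨ ^-congʳ a (ℕ.*-comm k (ℕ.pred N)) ⟩
    a ^ (ℕ.pred N ℕ.* k)   ≈⟨ ^-assocʳ a (ℕ.pred N) k ⟨
    (a ^ ℕ.pred N) ^ k     ≈⟨ ^-congˡ k (fermat′ a≉0) ⟩
    1# ^ k                 ≈⟨ 1^ k ⟩
    1#                     ∎

  -- Scaling by `g` multiplies the sum by `g ^ m` and merely permutes its terms, so one nonzero `g`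
  -- with `g ^ m ≉ 1#` suffices. Were there none, the remainder of `m` modulo `N − 1` would be a
  -- positive exponent with too many roots of unity.
  power-sum-vanishes : ∀ m → ¬ (ℕ.pred N ∣ m) → ∑all (_^ m) ≈ 0#
  power-sum-vanishes m ∤m with search
    (λ x≈y (x≉0 , x^m≉1) → (λ e → x≉0 (trans x≈y e)) , (λ e → x^m≉1 (trans (^-congˡ m x≈y) e)))
    (λ x → ¬? (x ≟ 0#) ×-dec ¬? (x ^ m ≟ 1#))
  ... | yes (g , g≉0 , g^m≉1) = integral (λ e → g^m≉1 (x-y≈0⇒x≈y e)) (begin
    (g ^ m - 1#) * ∑all (_^ m)                  ≈⟨ distribʳ _ _ _ ⟩
    g ^ m * ∑all (_^ m) + - 1# * ∑all (_^ m)    ≈⟨ +-cong shift (trans (sym (-‿distribˡ-* _ _)) (-‿cong (*-identityˡ _))) ⟩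
    ∑all (_^ m) - ∑all (_^ m)                   ≈⟨ -‿inverseʳ _ ⟩
    0#                                          ∎)
    where
    shift : g ^ m * ∑all (_^ m) ≈ ∑all (_^ m)
    shift = begin
      g ^ m * ∑all (_^ m)             ≈⟨ ∑all-scale (g ^ m) (_^ m) ⟩
      ∑all (λ x → g ^ m * x ^ m)      ≈⟨ ∑all-cong (λ x → trans (sym (^-distrib-* g x m)) (^-congˡ m (reflexive (≡.sym (scaling-to g≉0 x))))) ⟩
      ∑all ((_^ m) ∘ Inverse.to (scaling g≉0)) ≈⟨ ∑all-permute (^-congˡ m) (scaling g≉0) ⟩
      ∑all (_^ m)                     ∎
  ... | no none = contradiction all-unity (impossible N ≡.refl)
    where
    all-unity : ∀ x → x ≉ 0# → x ^ m ≈ 1#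
    all-unity x x≉0 with x ^ m ≟ 1#
    ... | yes e = e
    ... | no ne = contradiction (x , x≉0 , ne) none

    impossible : ∀ n → n ≡ N → ¬ (∀ x → x ≉ 0# → x ^ m ≈ 1#)
    impossible zero ≡.refl _ with index 0#
    ... | ()
    impossible (suc zero) ≡.refl _ with index 0# in e₀ | index 1# in e₁
    ... | zero | zero = 1≉0 (index-injective (≡.trans e₁ (≡.sym e₀)))
    impossible (suc (suc n)) ≡.refl unity with m % suc n in eq
    ... | zero  = ∤m (m%n≡0⇒n∣m m (suc n) eq)
    ... | suc r = nonroot-of-unity r (s≤s (s≤s (ℕ.≤-pred (subst (ℕ._< suc n) eq (m%n<n m (suc n)))))) λ x x≉0 → begin
      x ^ suc r                             ≈⟨ *-identityʳ _ ⟨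
      x ^ suc r * 1#                        ≈⟨ *-congˡ (fermat-multiple x≉0 (m / suc n)) ⟨
      x ^ suc r * x ^ (m / suc n ℕ.* suc n) ≈⟨ ^-homo-* x (suc r) _ ⟨
      x ^ (suc r ℕ.+ m / suc n ℕ.* suc n)   ≈⟨ ^-congʳ x (≡.trans (cong (ℕ._+ m / suc n ℕ.* suc n) (≡.sym eq)) (≡.sym (m≡m%n+[m/n]*n m (suc n)))) ⟩
      x ^ m                                 ≈⟨ unity x x≉0 ⟩
      1#                                    ∎

  -- All terms are 1 except that at 0, which vanishes because `m` is positive. Supplying the missing
  -- 1 gives `N ⊗ 1#`, so the sum is -1.
  power-sum≉0 : ∀ m .{{_ : NonZero m}} → ℕ.pred N ∣ m → ∑all (_^ m) ≉ 0#
  power-sum≉0 m (divides k ≡.refl) S≈0 = 1≉0 (begin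
    1#                                        ≈⟨ reflexive (choose-yes 1# 0# refl) ⟨
    choose 1# 0# 0#                           ≈⟨ ∑all-single (λ e → reflexive (choose-cong 1# 0# e)) 0# (λ x x≉0 → reflexive (choose-no 1# 0# x≉0)) ⟨
    ∑all (choose 1# 0#)                       ≈⟨ +-identityˡ _ ⟨
    0# + ∑all (choose 1# 0#)                  ≈⟨ +-congʳ S≈0 ⟨
    ∑all (_^ m) + ∑all (choose 1# 0#)         ≈⟨ ∑all-+ (_^ m) (choose 1# 0#) ⟨
    ∑all (λ x → x ^ m + choose 1# 0# x)       ≈⟨ ∑all-cong pointwise ⟩
    ∑all (λ _ → 1#)                           ≈⟨ sum-replicate N ⟩
    N ⊗ 1#                                    ≈⟨ card⊗1≈0 ⟩
    0#                                        ∎)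
    where
    pointwise : ∀ x → x ^ m + choose 1# 0# x ≈ 1#
    pointwise x with x ≟ 0#
    ... | yes x≈0 = trans (+-congʳ (trans (^-congˡ m x≈0) (0^ m))) (+-identityˡ 1#)
    ... | no  x≉0 = trans (+-congʳ (fermat-multiple x≉0 k)) (+-identityʳ 1#)

  -- Characteristic and Frobenius map

  ⊗-^ : ∀ p s → (p ℕ.^ s) ⊗ 1# ≈ (p ⊗ 1#) ^ s
  ⊗-^ p zero    = +-identityʳ 1#
  ⊗-^ p (suc s) = trans (×1-homo-* p (p ℕ.^ s)) (*-congˡ (⊗-^ p s))

  module Characteristic {p s} (prime : Prime p) (card : N ≡ p ℕ.^ s) where
    private instance
      p≢0 : NonZero p
      p≢0 = prime⇒nonZero prime

    -- The `s`-th power of `p ⊗ 1#` is `N ⊗ 1#`, which vanishes, and a field has no nilpotents.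
    p⊗1≈0 : p ⊗ 1# ≈ 0#
    p⊗1≈0 with p ⊗ 1# ≟ 0#
    ... | yes e = e
    ... | no ne = contradiction (trans (sym (⊗-^ p s)) (trans (×-congˡ (≡.sym card)) card⊗1≈0)) (^-≉0 s ne)

    ⊗-∣ : ∀ {m} → p ∣ m → ∀ x → m ⊗ x ≈ 0#
    ⊗-∣ (divides k ≡.refl) x = begin
      (k ℕ.* p) ⊗ x           ≈⟨ ×-congʳ (k ℕ.* p) (*-identityˡ x) ⟨
      (k ℕ.* p) ⊗ (1# * x)    ≈⟨ ×-assoc-* (k ℕ.* p) 1# x ⟨
      (k ℕ.* p) ⊗ 1# * x      ≈⟨ *-congʳ (×1-homo-* k p) ⟩
      k ⊗ 1# * p ⊗ 1# * x     ≈⟨ *-congʳ (trans (*-congˡ p⊗1≈0) (zeroʳ _)) ⟩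
      0# * x                  ≈⟨ zeroˡ x ⟩
      0#                      ∎

    -- By Bézout, if `p` and the nonzero remainder of `m` modulo `p` both vanished in the field, so
    -- would 1.
    ⊗-∤ : ∀ {m} → ¬ p ∣ m → m ⊗ 1# ≉ 0#
    ⊗-∤ {m} p∤m m⊗1≈0 with m % p in eq
    ... | zero  = p∤m (m%n≡0⇒n∣m m p eq)
    ... | suc r = 1≉0 (bezout (coprime-Bézout (prime⇒coprime prime (subst (ℕ._< p) eq (m%n<n m p)))))
      where
      r⊗1≈0 : suc r ⊗ 1# ≈ 0#
      r⊗1≈0 = begin
        suc r ⊗ 1#                          ≈⟨ +-identityʳ _ ⟨
        suc r ⊗ 1# + 0#                     ≈⟨ +-congˡ (⊗-∣ (divides (m / p) ≡.refl) 1#) ⟨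
        suc r ⊗ 1# + (m / p ℕ.* p) ⊗ 1#     ≈⟨ ×-homo-+ 1# (suc r) _ ⟨
        (suc r ℕ.+ m / p ℕ.* p) ⊗ 1#        ≈⟨ ×-congˡ (≡.trans (cong (ℕ._+ m / p ℕ.* p) (≡.sym eq)) (≡.sym (m≡m%n+[m/n]*n m p))) ⟩
        m ⊗ 1#                              ≈⟨ m⊗1≈0 ⟩
        0#                                  ∎
      kill : ∀ x y → y ⊗ 1# ≈ 0# → (x ℕ.* y) ⊗ 1# ≈ 0#
      kill x y e = trans (×1-homo-* x y) (trans (*-congˡ e) (zeroʳ _))
      combine : ∀ {x y} → 1 ℕ.+ x ≡ y → x ⊗ 1# ≈ 0# → y ⊗ 1# ≈ 0# → 1# ≈ 0#
      combine ≡.refl ex ey = trans (sym (+-identityʳ 1#)) (trans (+-congˡ (sym ex)) ey)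
      bezout : GCD.Bézout.Identity 1 p (suc r) → 1# ≈ 0#
      bezout (GCD.Bézout.+- x y e) = combine e (kill y (suc r) r⊗1≈0) (kill x p p⊗1≈0)
      bezout (GCD.Bézout.-+ x y e) = combine e (kill x p p⊗1≈0) (kill y (suc r) r⊗1≈0)

    frobenius-+ : ∀ x y → (x + y) ^ p ≈ x ^ p + y ^ p
    frobenius-+ x y = go p ≡.refl
      where
      open Algebra.Properties.CommutativeSemiring.Binomial commutativeSemiring
        using (theorem; binomialTerm)
      go : ∀ n → n ≡ p → (x + y) ^ n ≈ x ^ n + y ^ n
      go zero    ≡.refl = contradiction ≡.refl (ℕ.≢-nonZero⁻¹ 0)
      go (suc n) ≡.refl = begin
        (x + y) ^ suc n           ≈⟨ theorem (suc n) x y ⟩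
        t zero + sum (t ∘ suc)    ≈⟨ +-cong first (sum-init-last (t ∘ suc)) ⟩
        y ^ suc n + (sum (λ i → t (suc (inject₁ i))) + t (suc (fromℕ n)))
                                  ≈⟨ +-congˡ (+-cong (trans (sum-cong-≋ middle) (sum-replicate-zero n)) last) ⟩
        y ^ suc n + (0# + x ^ suc n) ≈⟨ +-comm _ _ ⟩
        0# + x ^ suc n + y ^ suc n   ≈⟨ +-congʳ (+-identityˡ _) ⟩
        x ^ suc n + y ^ suc n     ∎
        where
        t = binomialTerm x y (suc n)
        first : t zero ≈ y ^ suc n
        first = trans (×-homo-1 _) (*-identityˡ _)
        last : t (suc (fromℕ n)) ≈ x ^ suc n
        last = trans
          (×-cong (≡.trans (cong (λ k → suc n C suc k) (Fin.toℕ-fromℕ n)) (nCn≡1 (suc n)))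
            (*-cong (^-congʳ x (cong suc (Fin.toℕ-fromℕ n)))
              (^-congʳ y (≡.trans (cong (n ℕ.∸_) (Fin.toℕ-fromℕ n)) (ℕ.n∸n≡0 n)))))
          (trans (×-homo-1 _) (*-identityʳ _))
        middle : ∀ i → t (suc (inject₁ i)) ≈ 0#
        middle i = ⊗-∣ (Binomials.prime∣C prime (subst (ℕ._< n) (≡.sym (Fin.toℕ-inject₁ i)) (Fin.toℕ<n i))) _

    frobenius^-+ : ∀ j x y → (x + y) ^ (p ℕ.^ j) ≈ x ^ (p ℕ.^ j) + y ^ (p ℕ.^ j)
    frobenius^-+ zero x y = trans (*-identityʳ _) (sym (+-cong (*-identityʳ x) (*-identityʳ y)))
    frobenius^-+ (suc j) x y = begin
      (x + y) ^ (p ℕ.* p ℕ.^ j)             ≈⟨ ^-assocʳ (x + y) p _ ⟨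
      ((x + y) ^ p) ^ (p ℕ.^ j)             ≈⟨ ^-congˡ (p ℕ.^ j) (frobenius-+ x y) ⟩
      (x ^ p + y ^ p) ^ (p ℕ.^ j)           ≈⟨ frobenius^-+ j _ _ ⟩
      (x ^ p) ^ (p ℕ.^ j) + (y ^ p) ^ (p ℕ.^ j) ≈⟨ +-cong (^-assocʳ x p _) (^-assocʳ y p _) ⟩
      x ^ (p ℕ.^ suc j) + y ^ (p ℕ.^ suc j) ∎

    frobenius^-sum : ∀ j {n} (f : Fin n → Carrier) → sum f ^ (p ℕ.^ j) ≈ sum (λ i → f i ^ (p ℕ.^ j))
    frobenius^-sum j {zero}  f = 0^ (p ℕ.^ j) {{ℕ.m^n≢0 p j}}
    frobenius^-sum j {suc n} f = trans (frobenius^-+ j _ _) (+-congˡ (frobenius^-sum j (f ∘ suc)))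

    frobenius^- : ∀ j x → (- x) ^ (p ℕ.^ j) ≈ - (x ^ (p ℕ.^ j))
    frobenius^- j x = +-cancelʳ (x ^ (p ℕ.^ j)) _ _ (begin
      (- x) ^ (p ℕ.^ j) + x ^ (p ℕ.^ j)   ≈⟨ frobenius^-+ j _ _ ⟨
      (- x + x) ^ (p ℕ.^ j)               ≈⟨ ^-congˡ (p ℕ.^ j) (-‿inverseˡ x) ⟩
      0# ^ (p ℕ.^ j)                      ≈⟨ 0^ (p ℕ.^ j) {{ℕ.m^n≢0 p j}} ⟩
      0#                                  ≈⟨ -‿inverseˡ _ ⟨
      - (x ^ (p ℕ.^ j)) + x ^ (p ℕ.^ j)   ∎)

-- Finite sums of natural numbers

module Digits where
  open import Data.Nat.Base
  open import Data.Nat.Properties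
  open ≡

  ∑ : ℕ → (ℕ → ℕ) → ℕ
  ∑ zero    f = 0
  ∑ (suc n) f = f 0 + ∑ n (f ∘ suc)

  ∑-cong : ∀ n {f g} → (∀ k → k < n → f k ≡ g k) → ∑ n f ≡ ∑ n g
  ∑-cong zero    eq = refl
  ∑-cong (suc n) eq = cong₂ _+_ (eq 0 z<s) (∑-cong n λ k k<n → eq (suc k) (s<s k<n))

  ∑-+ : ∀ n f g → ∑ n (λ k → f k + g k) ≡ ∑ n f + ∑ n g
  ∑-+ zero    f g = refl
  ∑-+ (suc n) f g = trans (cong (f 0 + g 0 +_) (∑-+ n (f ∘ suc) (g ∘ suc)))
    (interchange (f 0) (g 0) _ _)
    where
    interchange : ∀ a b c d → a + b + (c + d) ≡ a + c + (b + d)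
    interchange = solve-∀

  ∑-* : ∀ n a f → ∑ n (λ k → a * f k) ≡ a * ∑ n f
  ∑-* zero    a f = sym (*-zeroʳ a)
  ∑-* (suc n) a f = trans (cong (a * f 0 +_) (∑-* n a (f ∘ suc))) (sym (*-distribˡ-+ a (f 0) _))

  ∑-zero : ∀ n f → ∑ n f ≡ 0 → ∀ k → k < n → f k ≡ 0
  ∑-zero (suc n) f eq zero    _         = m+n≡0⇒m≡0 (f 0) eq
  ∑-zero (suc n) f eq (suc k) (s≤s k<n) = ∑-zero n (f ∘ suc) (m+n≡0⇒n≡0 (f 0) eq) k k<n

  ∑-last : ∀ n f → ∑ (suc n) f ≡ ∑ n f + f n
  ∑-last zero    f = +-comm (f 0) 0
  ∑-last (suc n) f = trans (cong (f 0 +_) (∑-last n (f ∘ suc))) (sym (+-assoc (f 0) _ _))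

  ∑-cyclic : ∀ n f → f 0 ≡ f n → ∑ n (f ∘ suc) ≡ ∑ n f
  ∑-cyclic n f eq = +-cancelˡ-≡ (f 0) _ _ (trans (∑-last n f) (trans (cong (∑ n f +_) (sym eq)) (+-comm _ (f 0))))

  ∑-mono : ∀ n {f g} → (∀ k → k < n → f k ≤ g k) → ∑ n f ≤ ∑ n g
  ∑-mono zero    le = z≤n
  ∑-mono (suc n) le = +-mono-≤ (le 0 z<s) (∑-mono n λ k k<n → le (suc k) (s<s k<n))

  ∑-squeeze : ∀ n {f g} → (∀ k → k < n → f k ≤ g k) → ∑ n g ≤ ∑ n f → ∀ k → k < n → f k ≡ g k
  ∑-squeeze (suc n) {f} {g} le ge k k<sn = go k k<sn
    where
    tail≤ : ∑ n (f ∘ suc) ≤ ∑ n (g ∘ suc)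
    tail≤ = ∑-mono n λ k k<n → le (suc k) (s<s k<n)
    head≥ : g 0 ≤ f 0
    head≥ = +-cancelʳ-≤ (∑ n (f ∘ suc)) (g 0) (f 0) (≤-trans (+-monoʳ-≤ (g 0) tail≤) ge)
    tail≥ : ∑ n (g ∘ suc) ≤ ∑ n (f ∘ suc)
    tail≥ = +-cancelˡ-≤ (f 0) _ _ (≤-trans (+-monoˡ-≤ _ (le 0 z<s)) ge)
    go : ∀ k → k < suc n → f k ≡ g k
    go zero    _         = ≤-antisym (le 0 z<s) head≥
    go (suc k) (s≤s k<n) = ∑-squeeze n (λ k k<n → le (suc k) (s<s k<n)) tail≥ k k<n

  -- The cost of a single carry

  -- One step of a carry propagation, c′ being the carry out and c the carry in; each carry is
  -- given by its positive and negative parts.  ω relaxes the weight |c| of the carry by at most one.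
  module Step {π} (1≤π : 1 ≤ π) where

    -- This is `p c′ = c + (e₁ − e₂) − (f₁ − f₂)` freed of subtractions, for a carry out
    -- `c′ = x′ ≥ 0`. A negative carry out is covered by exchanging the indices 1 and 2 together
    -- with the signs.
    Carry : (c⁺ c⁻ x′ e₁ e₂ f₁ f₂ : ℕ) → Set
    Carry c⁺ c⁻ x′ e₁ e₂ f₁ f₂ = suc π * x′ + c⁻ + f₁ + e₂ ≡ c⁺ + e₁ + f₂

    -- The equation gives `f₁ + f₂ + |c| = p c′ + 2 c⁻ + 2 f₁ + e₂ − e₁`, and since `c′ ≥
    -- 1` the part `π c′` is at least `ω + 2 (e₁ + e₂) − ω′`. The bracket on the left is the slack,
    -- kept for the discussion of equality.
    positive : ∀ {c⁺ c⁻ x e₁ e₂ f₁ f₂ ω ω′} → Carry c⁺ c⁻ (suc x) e₁ e₂ f₁ f₂ →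
      ω′ ≤ 1 → ω + 2 * (e₁ + e₂) ≤ π + ω′ →
      e₁ + e₂ + (suc x ∸ ω′) + (2 * e₂ + 2 * f₁ + 2 * c⁻) ≤ f₁ + f₂ + (c⁺ + c⁻ ∸ ω)
    positive {c⁺} {c⁻} {x} {e₁} {e₂} {f₁} {f₂} {ω} {ω′} eq ω′≤1 U =
      +-cancelʳ-≤ (ω + ω′ + e₁) _ _ (begin
        e₁ + e₂ + y + (2 * e₂ + 2 * f₁ + 2 * c⁻) + (ω + ω′ + e₁)
          ≡⟨ ring₁ e₁ e₂ y f₁ c⁻ ω ω′ ⟩
        (ω + 2 * (e₁ + e₂)) + (y + ω′) + (e₂ + 2 * f₁ + 2 * c⁻)
          ≤⟨ +-monoˡ-≤ (e₂ + 2 * f₁ + 2 * c⁻) (+-mono-≤ U (≤-reflexive (m∸n+n≡m (≤-trans ω′≤1 (s≤s z≤n))))) ⟩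
        (π + ω′) + suc x + (e₂ + 2 * f₁ + 2 * c⁻)
          ≤⟨ m≤m+n _ (π * x) ⟩
        (π + ω′) + suc x + (e₂ + 2 * f₁ + 2 * c⁻) + π * x
          ≡⟨ ring₂ π x ω′ e₂ f₁ c⁻ ⟩
        (suc π * suc x + c⁻ + f₁ + e₂) + (f₁ + c⁻) + ω′
          ≡⟨ cong (λ z → z + (f₁ + c⁻) + ω′) eq ⟩
        (c⁺ + e₁ + f₂) + (f₁ + c⁻) + ω′
          ≡⟨ ring₃ c⁺ c⁻ e₁ f₁ f₂ ω′ ⟩
        f₁ + f₂ + (c⁺ + c⁻) + (ω′ + e₁)
          ≤⟨ +-monoˡ-≤ (ω′ + e₁) (+-monoʳ-≤ (f₁ + f₂) (m≤n+m∸n (c⁺ + c⁻) ω)) ⟩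
        f₁ + f₂ + (ω + z) + (ω′ + e₁)
          ≡⟨ ring₄ f₁ f₂ ω z ω′ e₁ ⟩
        f₁ + f₂ + z + (ω + ω′ + e₁) ∎)
      where
      open ≤-Reasoning
      y = suc x ∸ ω′
      z = c⁺ + c⁻ ∸ ω
      ring₁ : ∀ e₁ e₂ y f₁ c⁻ ω ω′ → e₁ + e₂ + y + (2 * e₂ + 2 * f₁ + 2 * c⁻) + (ω + ω′ + e₁)
        ≡ (ω + 2 * (e₁ + e₂)) + (y + ω′) + (e₂ + 2 * f₁ + 2 * c⁻)
      ring₁ = solve-∀
      ring₂ : ∀ π x ω′ e₂ f₁ c⁻ → (π + ω′) + suc x + (e₂ + 2 * f₁ + 2 * c⁻) + π * x
        ≡ (suc π * suc x + c⁻ + f₁ + e₂) + (f₁ + c⁻) + ω′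
      ring₂ = solve-∀
      ring₃ : ∀ c⁺ c⁻ e₁ f₁ f₂ ω′ → (c⁺ + e₁ + f₂) + (f₁ + c⁻) + ω′ ≡ f₁ + f₂ + (c⁺ + c⁻) + (ω′ + e₁)
      ring₃ = solve-∀
      ring₄ : ∀ f₁ f₂ ω z ω′ e₁ → f₁ + f₂ + (ω + z) + (ω′ + e₁) ≡ f₁ + f₂ + z + (ω + ω′ + e₁)
      ring₄ = solve-∀

    -- Equality annihilates the slack of `positive`. If also `e₁` is 0, then `c⁺ + f₂ = p c′`
    -- exceeds `c′`, so equality is possible only if the subtraction of `ω` really lowers `c⁺`.
    positive-eq : ∀ {c⁺ c⁻ x e₁ e₂ f₁ f₂ ω ω′} → Carry c⁺ c⁻ (suc x) e₁ e₂ f₁ f₂ →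
      ω′ ≤ 1 → ω ≤ 1 → ω + 2 * (e₁ + e₂) ≤ π + ω′ →
      e₁ + e₂ + (suc x ∸ ω′) ≡ f₁ + f₂ + (c⁺ + c⁻ ∸ ω) →
      e₂ ≡ 0 × c⁻ ≡ 0 × (e₁ ≡ 0 → c⁺ ≢ 0 × ω ≡ 1)
    positive-eq {c⁺} {c⁻} {x} {e₁} {e₂} {f₁} {f₂} {ω} {ω′} eq ω′≤1 ω≤1 U tight =
      e₂≡0 , c⁻≡0 , rest
      where
      slack : 2 * e₂ + 2 * f₁ + 2 * c⁻ ≡ 0
      slack = n≤0⇒n≡0 (+-cancelˡ-≤ (e₁ + e₂ + (suc x ∸ ω′)) _ _
        (≤-trans (positive {c⁺} {c⁻} {x} {e₁} {e₂} {f₁} {f₂} {ω} {ω′} eq ω′≤1 U) (≤-reflexive (trans (sym tight) (sym (+-identityʳ _))))))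
      half : ∀ n → 2 * n ≡ 0 → n ≡ 0
      half n e = m+n≡0⇒m≡0 n e
      e₂≡0 = half e₂ (m+n≡0⇒m≡0 (2 * e₂) (m+n≡0⇒m≡0 (2 * e₂ + 2 * f₁) slack))
      f₁≡0 = half f₁ (m+n≡0⇒n≡0 (2 * e₂) (m+n≡0⇒m≡0 (2 * e₂ + 2 * f₁) slack))
      c⁻≡0 = half c⁻ (m+n≡0⇒n≡0 (2 * e₂ + 2 * f₁) slack)
      rest : e₁ ≡ 0 → c⁺ ≢ 0 × ω ≡ 1
      rest refl with e₂≡0 | f₁≡0 | c⁻≡0
      ... | refl | refl | refl = (λ {refl → absurd (trans (0∸n≡0 ω) refl)}) , ω≡1 ω ω≤1 absurd
        where
        absurd : (c⁺ + 0 ∸ ω) ≢ c⁺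
        absurd e = <-irrefl refl (begin-strict
          suc x                        <⟨ m<m+n (suc x) (*-mono-≤ 1≤π (s≤s (z≤n {x}))) ⟩
          suc π * suc x                ≡⟨ zeros (suc π * suc x) ⟩
          suc π * suc x + 0 + 0 + 0    ≡⟨ eq ⟩
          c⁺ + 0 + f₂                  ≡⟨ trans (cong (_+ f₂) (+-identityʳ c⁺)) (+-comm c⁺ f₂) ⟩
          f₂ + c⁺                      ≡⟨ cong (f₂ +_) e ⟨
          f₂ + (c⁺ + 0 ∸ ω)            ≡⟨ tight ⟨
          suc x ∸ ω′                   ≤⟨ m∸n≤m (suc x) ω′ ⟩
          suc x                        ∎)
          where
          open ≤-Reasoning
          zeros : ∀ n → n ≡ n + 0 + 0 + 0
          zeros = solve-∀
        ω≡1 : ∀ ω → ω ≤ 1 → (c⁺ + 0 ∸ ω) ≢ c⁺ → ω ≡ 1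
        ω≡1 zero       _ ab = contradiction (+-identityʳ c⁺) ab
        ω≡1 (suc zero) _ _  = refl
        ω≡1 (suc (suc _)) (s≤s ()) _

    -- With no carry out, a nonzero `eᵢ` is bounded by the opposite side of the equation; where `ω`
    -- may be nonzero, there is no digit to bound.
    zero-carry : ∀ {c⁺ c⁻ e₁ e₂ f₁ f₂ ω} → c⁻ + f₁ + e₂ ≡ c⁺ + e₁ + f₂ →
      e₁ ≡ 0 ⊎ e₂ ≡ 0 → ω ≡ 0 ⊎ (e₁ ≡ 0 × e₂ ≡ 0) →
      e₁ + e₂ ≤ f₁ + f₂ + (c⁺ + c⁻ ∸ ω)
    zero-carry eq _ (inj₂ (refl , refl)) = z≤n
    zero-carry {c⁺} {c⁻} {e₂ = e₂} {f₁} {f₂} eq (inj₁ refl) (inj₁ refl) = begin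
      e₂                       ≤⟨ m≤n+m e₂ (c⁻ + f₁) ⟩
      c⁻ + f₁ + e₂             ≡⟨ eq ⟩
      c⁺ + 0 + f₂              ≤⟨ m≤m+n _ (f₁ + c⁻) ⟩
      c⁺ + 0 + f₂ + (f₁ + c⁻)  ≡⟨ ring c⁺ c⁻ f₁ f₂ ⟩
      f₁ + f₂ + (c⁺ + c⁻)      ∎
      where
      open ≤-Reasoning
      ring : ∀ c⁺ c⁻ f₁ f₂ → c⁺ + 0 + f₂ + (f₁ + c⁻) ≡ f₁ + f₂ + (c⁺ + c⁻)
      ring = solve-∀
    zero-carry {c⁺} {c⁻} {e₁} {f₁ = f₁} {f₂} eq (inj₂ refl) (inj₁ refl) = begin
      e₁ + 0                   ≤⟨ m≤n+m (e₁ + 0) (c⁺ + f₂) ⟩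
      c⁺ + f₂ + (e₁ + 0)       ≡⟨ ring₁ c⁺ e₁ f₂ ⟩
      c⁺ + e₁ + f₂             ≡⟨ eq ⟨
      c⁻ + f₁ + 0              ≤⟨ m≤m+n _ (f₂ + c⁺) ⟩
      c⁻ + f₁ + 0 + (f₂ + c⁺)  ≡⟨ ring₂ c⁺ c⁻ f₁ f₂ ⟩
      f₁ + f₂ + (c⁺ + c⁻)      ∎
      where
      open ≤-Reasoning
      ring₁ : ∀ c⁺ e₁ f₂ → c⁺ + f₂ + (e₁ + 0) ≡ c⁺ + e₁ + f₂
      ring₁ = solve-∀
      ring₂ : ∀ c⁺ c⁻ f₁ f₂ → c⁻ + f₁ + 0 + (f₂ + c⁺) ≡ f₁ + f₂ + (c⁺ + c⁻)
      ring₂ = solve-∀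

    -- If `e₁` is 0, the negative carry in has to be absorbed by `f₂`, which makes the digit sum of
    -- the `fᵢ` too large for equality.
    zero-carry-eq : ∀ {c⁻ e₁ e₂ f₁ f₂ ω} → suc c⁻ + f₁ + e₂ ≡ e₁ + f₂ →
      ω ≡ 0 ⊎ (ω ≡ 1 × e₁ ≡ 0 × e₂ ≡ 0) →
      e₁ + e₂ ≡ f₁ + f₂ + (suc c⁻ ∸ ω) → e₁ ≢ 0
    zero-carry-eq {c⁻} {e₂ = e₂} {f₁} {f₂} eq (inj₁ refl) tight refl = <-irrefl refl (begin-strict
      f₂                          <⟨ s≤s (m≤m+n f₂ (f₁ + c⁻)) ⟩
      suc (f₂ + (f₁ + c⁻))        ≡⟨ ring₁ f₂ f₁ c⁻ ⟩
      f₁ + f₂ + suc c⁻            ≡⟨ tight ⟨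
      e₂                          ≤⟨ m≤n+m e₂ (suc c⁻ + f₁) ⟩
      suc c⁻ + f₁ + e₂            ≡⟨ eq ⟩
      f₂                          ∎)
      where
      open ≤-Reasoning
      ring₁ : ∀ f₂ f₁ c⁻ → suc (f₂ + (f₁ + c⁻)) ≡ f₁ + f₂ + suc c⁻
      ring₁ = solve-∀
    zero-carry-eq {c⁻} {f₁ = f₁} {f₂} eq (inj₂ (refl , refl , refl)) tight _ =
      contradiction (trans eq f₂≡0) λ ()
      where
      f₂≡0 : f₂ ≡ 0
      f₂≡0 = m+n≡0⇒n≡0 f₁ (m+n≡0⇒m≡0 (f₁ + f₂) (sym tight))

  -- Uniqueness of the digits around the cycle

  module Uniqueness
    {π s′} (1≤π : 1 ≤ π) (e₁ e₂ ω : ℕ → ℕ)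
    (disjoint : ∀ k → e₁ k ≡ 0 ⊎ e₂ k ≡ 0)
    (ω-bit : ∀ k → ω k ≡ 0 ⊎ (ω k ≡ 1 × e₁ k ≡ 0 × e₂ k ≡ 0))
    (ω-start : ω 0 ≡ 0) (ω-stop : ω s′ ≡ 0) (ω-end : ω (suc s′) ≡ 0)
    (slope : ∀ k → ω k + 2 * (e₁ k + e₂ k) ≤ π + ω (suc k))
    -- The last three hypotheses break chains of negative carries: such a carry leaves a position
    -- only by a digit of `e₂` or by passing through a position marked by `ω`, and it ends at a
    -- digit of `e₁`.
    (gap : ∀ k → e₁ (suc k) ≢ 0 → e₂ k ≡ 0)
    (gap² : ∀ k → e₁ (2 + k) ≢ 0 → ω (suc k) ≢ 0 → e₂ k ≡ 0 × ω k ≡ 0)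
    (e₂-stop : e₂ s′ ≡ 0)
    where
    open Step 1≤π

    s : ℕ
    s = suc s′

    ω≤1 : ∀ k → ω k ≤ 1
    ω≤1 k with ω-bit k
    ... | inj₁ e       = ≤-trans (≤-reflexive e) z≤n
    ... | inj₂ (e , _) = ≤-reflexive e

    module _
      (f₁ f₂ c⁺ c⁻ : ℕ → ℕ)
      (sign : ∀ k → c⁺ k ≡ 0 ⊎ c⁻ k ≡ 0)
      (carry : ∀ k → k < s → suc π * c⁺ (suc k) + c⁻ k + f₁ k + e₂ k ≡ suc π * c⁻ (suc k) + c⁺ k + e₁ k + f₂ k)
      (cyclic⁺ : c⁺ 0 ≡ c⁺ s) (cyclic⁻ : c⁻ 0 ≡ c⁻ s)
      (light₁ : ∑ s f₁ ≤ ∑ s e₁) (light₂ : ∑ s f₂ ≤ ∑ s e₂)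
      where

      -- `φ` is the potential of a carry. One step reads `b k ≤ a k`, with the carry out on the left
      -- and the carry in on the right, so that the potentials cancel in the sums over the cycle.
      φ a b : ℕ → ℕ
      φ k = c⁺ k + c⁻ k ∸ ω k
      a k = f₁ k + f₂ k + φ k
      b k = e₁ k + e₂ k + φ (suc k)

      carry⁺ : ∀ k → k < s → c⁻ (suc k) ≡ 0 → Carry (c⁺ k) (c⁻ k) (c⁺ (suc k)) (e₁ k) (e₂ k) (f₁ k) (f₂ k)
      carry⁺ k k<s e = trans (carry k k<s) (cong (λ z → z + c⁺ k + e₁ k + f₂ k) (trans (cong (suc π *_) e) (*-zeroʳ (suc π))))

      carry⁻ : ∀ k → k < s → c⁺ (suc k) ≡ 0 → Carry (c⁻ k) (c⁺ k) (c⁻ (suc k)) (e₂ k) (e₁ k) (f₂ k) (f₁ k)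
      carry⁻ k k<s e = trans (swap (suc π * c⁻ (suc k) + c⁺ k) (e₁ k) (f₂ k)) (trans (sym (carry k k<s))
        (trans (cong (λ z → z + c⁻ k + f₁ k + e₂ k) (trans (cong (suc π *_) e) (*-zeroʳ (suc π))))
          (swap (c⁻ k) (e₂ k) (f₁ k))))
        where
        swap : ∀ x y z → x + z + y ≡ x + y + z
        swap = solve-∀

      flip-slope : ∀ k → ω k + 2 * (e₂ k + e₁ k) ≤ π + ω (suc k)
      flip-slope k = subst (λ z → ω k + 2 * z ≤ π + ω (suc k)) (+-comm (e₁ k) (e₂ k)) (slope k)

      ω-cases : ∀ k → ω k ≡ 0 ⊎ (e₁ k ≡ 0 × e₂ k ≡ 0)
      ω-cases k with ω-bit k
      ... | inj₁ e       = inj₁ e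
      ... | inj₂ (_ , e) = inj₂ e

      b≤a : ∀ k → k < s → b k ≤ a k
      b≤a k k<s with sign (suc k)
      b≤a k k<s | inj₂ e⁻ with c⁺ (suc k) in e⁺
      ... | zero rewrite e⁻ | 0∸n≡0 (ω (suc k)) | +-identityʳ (e₁ k + e₂ k) =
        zero-carry {c⁺ k} {c⁻ k} {e₁ k} {e₂ k} {f₁ k} {f₂ k} (trans (cong (λ z → z + c⁻ k + f₁ k + e₂ k) (sym (trans (cong (suc π *_) e⁺) (*-zeroʳ π)))) (carry⁺ k k<s e⁻)) (disjoint k) (ω-cases k)
      ... | suc x rewrite e⁻ | +-identityʳ x = ≤-trans (m≤m+n _ _)
        (positive {c⁺ k} {c⁻ k} {x} {e₁ k} {e₂ k} {f₁ k} {f₂ k} {ω k} {ω (suc k)} (subst (λ z → Carry (c⁺ k) (c⁻ k) z (e₁ k) (e₂ k) (f₁ k) (f₂ k)) e⁺ (carry⁺ k k<s e⁻)) (ω≤1 (suc k)) (slope k))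
      b≤a k k<s | inj₁ e⁺ with c⁻ (suc k) in e⁻
      ... | zero rewrite e⁺ | 0∸n≡0 (ω (suc k)) | +-identityʳ (e₁ k + e₂ k) =
        zero-carry {c⁺ k} {c⁻ k} {e₁ k} {e₂ k} {f₁ k} {f₂ k} (trans (cong (λ z → z + c⁻ k + f₁ k + e₂ k) (sym (trans (cong (suc π *_) e⁺) (*-zeroʳ π)))) (carry⁺ k k<s e⁻)) (disjoint k) (ω-cases k)
      ... | suc x rewrite e⁺ | +-comm (e₁ k) (e₂ k) | +-comm (f₁ k) (f₂ k) | +-comm (c⁺ k) (c⁻ k) = ≤-trans (m≤m+n _ _)
        (positive {c⁻ k} {c⁺ k} {x} {e₂ k} {e₁ k} {f₂ k} {f₁ k} {ω k} {ω (suc k)} (subst (λ z → Carry (c⁻ k) (c⁺ k) z (e₂ k) (e₁ k) (f₂ k) (f₁ k)) e⁻ (carry⁻ k k<s e⁺)) (ω≤1 (suc k)) (flip-slope k))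

      φ-cyclic : ∑ s (φ ∘ suc) ≡ ∑ s φ
      φ-cyclic = ∑-cyclic s φ (cong₂ _∸_ (cong₂ _+_ cyclic⁺ cyclic⁻) (trans ω-start (sym ω-end)))

      ∑a : ∑ s a ≡ ∑ s f₁ + ∑ s f₂ + ∑ s φ
      ∑a = trans (∑-+ s (λ k → f₁ k + f₂ k) φ) (cong (_+ ∑ s φ) (∑-+ s f₁ f₂))

      ∑b : ∑ s b ≡ ∑ s e₁ + ∑ s e₂ + ∑ s φ
      ∑b = trans (∑-+ s (λ k → e₁ k + e₂ k) (φ ∘ suc)) (cong₂ _+_ (∑-+ s e₁ e₂) φ-cyclic)

      -- Up to the common potential, the sums of `a` and `b` are the digit sums of the `fᵢ` and of
      -- the `eᵢ`, and the former are not larger.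
      tight : ∀ k → k < s → b k ≡ a k
      tight = ∑-squeeze s b≤a (≤-trans (≤-reflexive ∑a) (≤-trans (+-monoˡ-≤ (∑ s φ) (+-mono-≤ light₁ light₂)) (≤-reflexive (sym ∑b))))

      tight′ : ∀ k → k < s → e₁ k + e₂ k + (c⁺ (suc k) + c⁻ (suc k) ∸ ω (suc k)) ≡ f₁ k + f₂ k + (c⁺ k + c⁻ k ∸ ω k)
      tight′ = tight

      c⁺≡0 : ∀ {k} → c⁻ k ≢ 0 → c⁺ k ≡ 0
      c⁺≡0 {k} ne with sign k
      ... | inj₁ e = e
      ... | inj₂ e = contradiction e ne

      -- The mirror image of `positive-eq`, with indices and signs exchanged.
      negative-out : ∀ k → k < s → c⁻ (suc k) ≢ 0 → e₂ k ≡ 0 → c⁻ k ≢ 0 × ω k ≢ 0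
      negative-out k k<s ne e₂≡0
        with c⁺≡0 {suc k} ne | c⁻ (suc k) in e⁻ | tight′ k k<s
      ... | _  | zero  | _ = contradiction e⁻ ne
      ... | e⁺ | suc x | t
        rewrite e⁺ | +-comm (e₁ k) (e₂ k) | +-comm (f₁ k) (f₂ k) | +-comm (c⁺ k) (c⁻ k)
        with positive-eq {c⁻ k} {c⁺ k} {x} {e₂ k} {e₁ k} {f₂ k} {f₁ k} {ω k} {ω (suc k)} (subst (λ z → Carry (c⁻ k) (c⁺ k) z (e₂ k) (e₁ k) (f₂ k) (f₁ k)) e⁻ (carry⁻ k k<s e⁺)) (ω≤1 (suc k)) (ω≤1 k) (flip-slope k) t
      ... | _ , _ , rest with rest e₂≡0
      ... | c≢0 , ω≡1 = c≢0 , λ ω≡0 → contradiction (trans (sym ω≡0) ω≡1) λ ()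

      negative-in : ∀ k → k < s → c⁻ k ≢ 0 → c⁻ (suc k) ≡ 0 → e₁ k ≢ 0
      negative-in k k<s ne e⁻ with c⁺≡0 {k} ne | c⁻ k in e | tight′ k k<s
      ... | _  | zero  | _ = contradiction e ne
      ... | e⁺ | suc x | t with c⁺ (suc k) in eq⁺
      ... | zero rewrite e⁺ | e⁻ | 0∸n≡0 (ω (suc k)) | +-identityʳ (e₁ k + e₂ k) =
        zero-carry-eq {x} {e₁ k} {e₂ k} {f₁ k} {f₂ k} (trans (sym (carry-in)) (trans (carry⁺ k k<s e⁻) (cong (λ z → z + e₁ k + f₂ k) e⁺))) (ω-bit k) t
        where
        carry-in : suc π * c⁺ (suc k) + c⁻ k + f₁ k + e₂ k ≡ suc x + f₁ k + e₂ k
        carry-in = cong₂ (λ y z → y + z + f₁ k + e₂ k) (trans (cong (suc π *_) eq⁺) (*-zeroʳ π)) e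
      -- A tight step with a positive carry out leaves no slack for a negative carry in.
      ... | suc y rewrite e⁻ | +-identityʳ y
        with positive-eq {c⁺ k} {suc x} {y} {e₁ k} {e₂ k} {f₁ k} {f₂ k} {ω k} {ω (suc k)} (subst₂ (λ z w → Carry (c⁺ k) w z (e₁ k) (e₂ k) (f₁ k) (f₂ k)) eq⁺ e (carry⁺ k k<s e⁻)) (ω≤1 (suc k)) (ω≤1 k) (slope k) t
      ... | _ , () , _

      -- The top position has neither a digit of `e₂` nor a mark of `ω`, so no negative carry leaves
      -- it.
      nonneg-end : c⁻ s ≡ 0
      nonneg-end with c⁻ s ≟ 0
      ... | yes e = e
      ... | no ne = contradiction ω-stop (proj₂ (negative-out s′ (n<1+n s′) ne e₂-stop))

      -- A negative carry that ends here ends at a digit of `e₁`. By `gap` it must have passed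
      -- through a mark one position below, and by `gap²` the position below that has neither a
      -- digit of `e₂` nor a mark, so the carry cannot have left it. At position 0 the cycle leads
      -- back to the top.
      nonneg-below : ∀ k → k < s → c⁻ (suc k) ≡ 0 → c⁻ k ≡ 0
      nonneg-below k k<s e with c⁻ k ≟ 0
      ... | yes e′ = e′
      ... | no ne with negative-in k k<s ne e
      nonneg-below zero k<s e | no ne | _ = contradiction (trans cyclic⁻ nonneg-end) ne
      nonneg-below (suc k) k<s e | no ne | e₁≢0 with negative-out k (<⇒≤ k<s) ne (gap k e₁≢0)
      nonneg-below (suc zero) k<s e | no ne | e₁≢0 | _ , ω≢0 = contradiction ω-start ω≢0
      nonneg-below (suc (suc k)) k<s e | no ne | e₁≢0 | ne′ , ω≢0 with gap² k e₁≢0 ω≢0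
      ... | e₂≡0 , ω≡0 = contradiction ω≡0 (proj₂ (negative-out k (<⇒≤ (<⇒≤ k<s)) ne′ e₂≡0))

      nonneg : ∀ k → k ≤ s → c⁻ k ≡ 0
      nonneg k k≤s = go (s ∸ k) k (m+[n∸m]≡n k≤s)
        where
        go : ∀ d k → k + d ≡ s → c⁻ k ≡ 0
        go zero    k eq = subst (λ z → c⁻ z ≡ 0) (sym (trans (sym (+-identityʳ k)) eq)) nonneg-end
        go (suc d) k eq = nonneg-below k (≤-trans (m<m+n k z<s) (≤-reflexive eq))
          (go d (suc k) (trans (sym (+-suc k d)) eq))

      totals : ∑ s e₁ + ∑ s e₂ ≡ ∑ s f₁ + ∑ s f₂
      totals = +-cancelʳ-≡ (∑ s φ) _ _ (trans (sym ∑b) (trans (∑-cong s tight) ∑a))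

      total₁ : ∑ s f₁ ≡ ∑ s e₁
      total₁ = ≤-antisym light₁ (+-cancelʳ-≤ (∑ s e₂) _ _ (≤-trans (≤-reflexive totals) (+-monoʳ-≤ (∑ s f₁) light₂)))

      total₂ : ∑ s f₂ ≡ ∑ s e₂
      total₂ = +-cancelˡ-≡ (∑ s f₁) _ _ (trans (sym totals) (cong (_+ ∑ s e₂) (sym total₁)))

      carry′ : ∀ k → k < s → suc π * c⁺ (suc k) + f₁ k + e₂ k ≡ c⁺ k + e₁ k + f₂ k
      carry′ k k<s = trans (cong (λ z → z + f₁ k + e₂ k)
        (trans (sym (+-identityʳ _)) (cong (suc π * c⁺ (suc k) +_) (sym (nonneg k (<⇒≤ k<s))))))
        (carry⁺ k k<s (nonneg (suc k) k<s))

      -- In the sum of all carry equations the digit sums cancel by `total₁` and `total₂`. What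
      -- remains says that the sum of the carries equals `p` times itself.
      no-carry : ∑ s c⁺ ≡ 0
      no-carry = m*n≡0⇒m≡0 _ π {{>-nonZero 1≤π}} (trans (*-comm (∑ s c⁺) π) (+-cancelʳ-≡ (∑ s c⁺ + ∑ s f₁ + ∑ s e₂) _ _ (begin
        π * S + (S + ∑ s f₁ + ∑ s e₂)    ≡⟨ ring π S (∑ s f₁) (∑ s e₂) ⟩
        suc π * S + ∑ s f₁ + ∑ s e₂      ≡⟨ cong (λ z → suc π * z + ∑ s f₁ + ∑ s e₂) (∑-cyclic s c⁺ cyclic⁺) ⟨
        suc π * ∑ s (c⁺ ∘ suc) + ∑ s f₁ + ∑ s e₂ ≡⟨ cong (λ z → z + ∑ s f₁ + ∑ s e₂) (∑-* s (suc π) (c⁺ ∘ suc)) ⟨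
        ∑ s (λ k → suc π * c⁺ (suc k)) + ∑ s f₁ + ∑ s e₂ ≡⟨ ∑-+₃ (λ k → suc π * c⁺ (suc k)) f₁ e₂ ⟨
        ∑ s (λ k → suc π * c⁺ (suc k) + f₁ k + e₂ k) ≡⟨ ∑-cong s carry′ ⟩
        ∑ s (λ k → c⁺ k + e₁ k + f₂ k)   ≡⟨ ∑-+₃ c⁺ e₁ f₂ ⟩
        S + ∑ s e₁ + ∑ s f₂              ≡⟨ cong₂ (λ y z → S + y + z) (sym total₁) total₂ ⟩
        S + ∑ s f₁ + ∑ s e₂              ∎)))
        where
        open ≡-Reasoning
        S = ∑ s c⁺
        ring : ∀ π S x y → π * S + (S + x + y) ≡ suc π * S + x + y
        ring = solve-∀
        ∑-+₃ : ∀ f g h → ∑ s (λ k → f k + g k + h k) ≡ ∑ s f + ∑ s g + ∑ s h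
        ∑-+₃ f g h = trans (∑-+ s (λ k → f k + g k) h) (cong (_+ ∑ s h) (∑-+ s f g))

      c⁺-zero : ∀ k → k ≤ s → c⁺ k ≡ 0
      c⁺-zero k k≤s with m≤n⇒m<n∨m≡n k≤s
      ... | inj₁ k<s  = ∑-zero s c⁺ no-carry k k<s
      ... | inj₂ refl = trans (sym cyclic⁺) (∑-zero s c⁺ no-carry 0 z<s)

      φ-zero : ∀ k → k ≤ s → φ k ≡ 0
      φ-zero k k≤s = trans (cong (_∸ ω k) (cong₂ _+_ (c⁺-zero k k≤s) (nonneg k k≤s))) (0∸n≡0 (ω k))

      balance : ∀ k → k < s → f₁ k + e₂ k ≡ e₁ k + f₂ k
      balance k k<s = trans (cong (λ z → z + f₁ k + e₂ k) (sym (trans (cong (suc π *_) (c⁺-zero (suc k) k<s)) (*-zeroʳ π))))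
        (trans (carry′ k k<s) (cong (λ z → z + e₁ k + f₂ k) (c⁺-zero k (<⇒≤ k<s))))

      weights : ∀ k → k < s → e₁ k + e₂ k ≡ f₁ k + f₂ k
      weights k k<s = begin
        e₁ k + e₂ k        ≡⟨ +-identityʳ _ ⟨
        e₁ k + e₂ k + 0    ≡⟨ cong (e₁ k + e₂ k +_) (φ-zero (suc k) k<s) ⟨
        b k                ≡⟨ tight k k<s ⟩
        a k                ≡⟨ cong (f₁ k + f₂ k +_) (φ-zero k (<⇒≤ k<s)) ⟩
        f₁ k + f₂ k + 0    ≡⟨ +-identityʳ _ ⟩
        f₁ k + f₂ k        ∎
        where open ≡-Reasoning

      -- Without carries, `f₁ − f₂` agrees with `e₁ − e₂` at each position, and by tightness
      -- `f₁ + f₂` agrees with `e₁ + e₂`.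
      unique₁ : ∀ k → k < s → f₁ k ≡ e₁ k
      unique₁ k k<s = *-cancelˡ-≡ (f₁ k) (e₁ k) 2 (+-cancelʳ-≡ (f₂ k + e₂ k) _ _ (begin
        2 * f₁ k + (f₂ k + e₂ k)       ≡⟨ ring (f₁ k) (f₂ k) (e₂ k) ⟩
        (f₁ k + f₂ k) + (f₁ k + e₂ k)  ≡⟨ cong₂ _+_ (sym (weights k k<s)) (balance k k<s) ⟩
        (e₁ k + e₂ k) + (e₁ k + f₂ k)  ≡⟨ ring′ (e₁ k) (f₂ k) (e₂ k) ⟨
        2 * e₁ k + (f₂ k + e₂ k)       ∎))
        where
        open ≡-Reasoning
        ring : ∀ x y z → 2 * x + (y + z) ≡ (x + y) + (x + z)
        ring = solve-∀
        ring′ : ∀ x y z → 2 * x + (y + z) ≡ (x + z) + (x + y)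
        ring′ = solve-∀

      unique₂ : ∀ k → k < s → f₂ k ≡ e₂ k
      unique₂ k k<s = +-cancelˡ-≡ (f₁ k) _ _ (trans (sym (weights k k<s)) (cong (_+ e₂ k) (sym (unique₁ k k<s))))

-- Target digits: rigidity, and construction for odd p

module Targets where
  open Digits
  open import Data.Nat.Base
  open import Data.Nat.Properties
  open ≡

  val : ℕ → ℕ → (ℕ → ℕ) → ℕ
  val p s f = ∑ s (λ k → f k * p ^ k)

  val-+ : ∀ p s f g → val p s (λ k → f k + g k) ≡ val p s f + val p s g
  val-+ p s f g = trans (∑-cong s (λ k _ → *-distribʳ-+ (p ^ k) (f k) (g k))) (∑-+ s _ _)

  module Horner (p : ℕ) (D : ℕ → ℕ) (t : ℕ) where
    horner : ℕ → ℕ → ℕ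
    horner zero    k = t
    horner (suc n) k = p * horner n (suc k) + D k

    horner-closed : ∀ n k → horner n k ≡ p ^ n * t + ∑ n (λ i → D (k + i) * p ^ i)
    horner-closed zero    k = sym (trans (+-identityʳ _) (*-identityˡ t))
    horner-closed (suc n) k = begin
      p * horner n (suc k) + D k
        ≡⟨ cong (λ z → p * z + D k) (horner-closed n (suc k)) ⟩
      p * (p ^ n * t + ∑ n (λ i → D (suc k + i) * p ^ i)) + D k
        ≡⟨ ring p (p ^ n) t _ (D k) ⟩
      p * p ^ n * t + (D k * 1 + p * ∑ n (λ i → D (suc k + i) * p ^ i))
        ≡⟨ cong₂ (λ y z → p * p ^ n * t + (D y * 1 + z)) (sym (+-identityʳ k)) shift ⟩
      p * p ^ n * t + (D (k + 0) * 1 + ∑ n (λ i → D (k + suc i) * p ^ suc i)) ∎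
      where
      open ≡-Reasoning
      ring : ∀ p q t x y → p * (q * t + x) + y ≡ p * q * t + (y * 1 + p * x)
      ring = solve-∀
      ring′ : ∀ p x y → p * (x * y) ≡ x * (p * y)
      ring′ = solve-∀
      shift : p * ∑ n (λ i → D (suc k + i) * p ^ i) ≡ ∑ n (λ i → D (k + suc i) * p ^ suc i)
      shift = trans (sym (∑-* n p _)) (∑-cong n λ i _ →
        trans (ring′ p (D (suc k + i)) (p ^ i)) (cong (λ z → D z * p ^ suc i) (sym (+-suc k i))))

  -- The conditions of `Uniqueness` on the digits, together with the digit sums `p − 1` on residue
  -- classes that make the monomials occur in the two indicator polynomials.
  record Target (π s′ R₁ d₁ R₂ d₂ : ℕ) : Set where
    field
      e₁ e₂ ω  : ℕ → ℕ
      disjoint : ∀ k → e₁ k ≡ 0 ⊎ e₂ k ≡ 0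
      ω-bit    : ∀ k → ω k ≡ 0 ⊎ (ω k ≡ 1 × e₁ k ≡ 0 × e₂ k ≡ 0)
      ω-start  : ω 0 ≡ 0
      ω-stop   : ω s′ ≡ 0
      ω-end    : ω (suc s′) ≡ 0
      slope    : ∀ k → ω k + 2 * (e₁ k + e₂ k) ≤ π + ω (suc k)
      gap      : ∀ k → e₁ (suc k) ≢ 0 → e₂ k ≡ 0
      gap²     : ∀ k → e₁ (2 + k) ≢ 0 → ω (suc k) ≢ 0 → e₂ k ≡ 0 × ω k ≡ 0
      e₂-stop  : e₂ s′ ≡ 0
      class₁   : ∀ j → j < R₁ → ∑ d₁ (λ i → e₁ (i * R₁ + j)) ≡ π
      class₂   : ∀ j → j < R₂ → ∑ d₂ (λ i → e₂ (i * R₂ + j)) ≡ π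

  module Rigid {π s′ R₁ d₁ R₂ d₂} (1≤π : 1 ≤ π) (T : Target π s′ R₁ d₁ R₂ d₂) {μ} (card : suc π ^ suc s′ ≡ 2 + μ) where
    open Target T
    private
      s = suc s′
      p = suc π
      v = val p s

    -- As `μ` is -1 modulo `suc μ`, which is `p^s − 1`, the divisibility says that `v f₁ − v f₂` and
    -- `v e₁ − v e₂` are congruent. The partial results of Horner's scheme for their difference are
    -- the carries required by `Uniqueness`.
    rigid : ∀ f₁ f₂ → ∑ s f₁ ≤ ∑ s e₁ → ∑ s f₂ ≤ ∑ s e₂ →
      suc μ ∣ (μ * v e₁ + v e₂) + (v f₁ + μ * v f₂) →
      ∀ k → k < s → f₁ k ≡ e₁ k × f₂ k ≡ e₂ k
    rigid f₁ f₂ light₁ light₂ (divides K eqK) k k<s =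
      U.unique₁ f₁ f₂ c⁺ c⁻ sign carry cyclic⁺ cyclic⁻ light₁ light₂ k k<s ,
      U.unique₂ f₁ f₂ c⁺ c⁻ sign carry cyclic⁺ cyclic⁻ light₁ light₂ k k<s
      where
      module U = Uniqueness 1≤π e₁ e₂ ω disjoint ω-bit ω-start ω-stop ω-end slope gap gap² e₂-stop
      -- The schemes start at the top with `A` and `K` because `A − K` is the quotient of
      -- `v e₁ + v f₂ − v f₁ − v e₂` by `p^s − 1`; this is the carry for which the scheme returns to
      -- its initial value.
      A = v e₁ + v f₂
      open Horner p (λ k → f₁ k + e₂ k) A renaming (horner to hP; horner-closed to hP-closed)
      open Horner p (λ k → e₁ k + f₂ k) K renaming (horner to hM; horner-closed to hM-closed)
      P M c⁺ c⁻ : ℕ → ℕ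
      P k = hP (s ∸ k) k
      M k = hM (s ∸ k) k
      c⁺ k = P k ∸ M k
      c⁻ k = M k ∸ P k

      sign : ∀ k → c⁺ k ≡ 0 ⊎ c⁻ k ≡ 0
      sign k with ≤-total (P k) (M k)
      ... | inj₁ le = inj₁ (m≤n⇒m∸n≡0 le)
      ... | inj₂ le = inj₂ (m≤n⇒m∸n≡0 le)

      parts : ∀ k → c⁺ k + M k ≡ c⁻ k + P k
      parts k with ≤-total (P k) (M k)
      ... | inj₁ le = trans (cong (_+ M k) (m≤n⇒m∸n≡0 le)) (sym (m∸n+n≡m le))
      ... | inj₂ le = trans (m∸n+n≡m le) (sym (cong (_+ P k) (m≤n⇒m∸n≡0 le)))

      suc-∸ : ∀ {m n} → m < n → n ∸ m ≡ suc (n ∸ suc m)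
      suc-∸ {zero}  {suc n} _         = refl
      suc-∸ {suc m} {suc n} (s≤s m<n) = suc-∸ m<n

      P-step : ∀ k → k < s → P k ≡ p * P (suc k) + (f₁ k + e₂ k)
      P-step k k<s = cong (λ z → hP z k) (suc-∸ k<s)

      M-step : ∀ k → k < s → M k ≡ p * M (suc k) + (e₁ k + f₂ k)
      M-step k k<s = cong (λ z → hM z k) (suc-∸ k<s)

      carry : ∀ k → k < s → p * c⁺ (suc k) + c⁻ k + f₁ k + e₂ k ≡ p * c⁻ (suc k) + c⁺ k + e₁ k + f₂ k
      carry k k<s = +-cancelʳ-≡ (p * M (suc k) + M k) _ _ (begin
        p * c⁺ (suc k) + c⁻ k + f₁ k + e₂ k + (p * M (suc k) + M k)
          ≡⟨ ring₁ p (c⁺ (suc k)) (M (suc k)) (c⁻ k) (f₁ k) (e₂ k) (M k) ⟩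
        p * (c⁺ (suc k) + M (suc k)) + (c⁻ k + (f₁ k + e₂ k) + M k)
          ≡⟨ cong (λ z → p * z + (c⁻ k + (f₁ k + e₂ k) + M k)) (parts (suc k)) ⟩
        p * (c⁻ (suc k) + P (suc k)) + (c⁻ k + (f₁ k + e₂ k) + M k)
          ≡⟨ ring₂ p (c⁻ (suc k)) (P (suc k)) (c⁻ k) (f₁ k) (e₂ k) (M k) ⟩
        p * c⁻ (suc k) + (c⁻ k + (p * P (suc k) + (f₁ k + e₂ k))) + M k
          ≡⟨ cong (λ z → p * c⁻ (suc k) + (c⁻ k + z) + M k) (P-step k k<s) ⟨
        p * c⁻ (suc k) + (c⁻ k + P k) + M k
          ≡⟨ cong₂ (λ y z → p * c⁻ (suc k) + y + z) (sym (parts k)) (M-step k k<s) ⟩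
        p * c⁻ (suc k) + (c⁺ k + M k) + (p * M (suc k) + (e₁ k + f₂ k))
          ≡⟨ ring₃ (p * c⁻ (suc k)) (c⁺ k) (M k) (p * M (suc k)) (e₁ k) (f₂ k) ⟩
        p * c⁻ (suc k) + c⁺ k + e₁ k + f₂ k + (p * M (suc k) + M k) ∎)
        where
        open ≡-Reasoning
        ring₁ : ∀ p a b c f e m → p * a + c + f + e + (p * b + m) ≡ p * (a + b) + (c + (f + e) + m)
        ring₁ = solve-∀
        ring₂ : ∀ p a b c f e m → p * (a + b) + (c + (f + e) + m) ≡ p * a + (c + (p * b + (f + e))) + m
        ring₂ = solve-∀
        ring₃ : ∀ a b m n e f → a + (b + m) + (n + (e + f)) ≡ a + b + e + f + (n + m)
        ring₃ = solve-∀

      turn : P 0 + K ≡ M 0 + A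
      turn = begin
        P 0 + K
          ≡⟨ cong (_+ K) (trans (hP-closed s 0) (cong₂ (λ y z → y * A + z) card (val-+ p s f₁ e₂))) ⟩
        (2 + μ) * A + (v f₁ + v e₂) + K
          ≡⟨ ring₁ μ (v e₁) (v f₂) (v f₁) (v e₂) K ⟩
        A + A + (μ * v e₁ + v e₂ + (v f₁ + μ * v f₂)) + K
          ≡⟨ cong (λ z → A + A + z + K) eqK ⟩
        A + A + K * suc μ + K
          ≡⟨ ring₂ μ A K ⟩
        (2 + μ) * K + A + A
          ≡⟨ cong (_+ A) (trans (hM-closed s 0) (cong₂ (λ y z → y * K + z) card (val-+ p s e₁ f₂))) ⟨
        M 0 + A ∎
        where
        open ≡-Reasoning
        ring₁ : ∀ μ a b c d k → (2 + μ) * (a + b) + (c + d) + k ≡ (a + b) + (a + b) + (μ * a + d + (c + μ * b)) + k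
        ring₁ = solve-∀
        ring₂ : ∀ μ a k → a + a + k * suc μ + k ≡ (2 + μ) * k + a + a
        ring₂ = solve-∀

      ∸-balance : ∀ {a b c d} → a + d ≡ c + b → a ∸ c ≡ b ∸ d
      ∸-balance {a} {b} {c} {d} eq = begin
        a ∸ c              ≡⟨ [m+n]∸[m+o]≡n∸o d a c ⟨
        (d + a) ∸ (d + c)  ≡⟨ cong₂ _∸_ (trans (+-comm d a) eq) (+-comm d c) ⟩
        (c + b) ∸ (c + d)  ≡⟨ [m+n]∸[m+o]≡n∸o c b d ⟩
        b ∸ d              ∎
        where open ≡-Reasoning

      P-end : P s ≡ A
      P-end = cong (λ z → hP z s) (n∸n≡0 s)

      M-end : M s ≡ K
      M-end = cong (λ z → hM z s) (n∸n≡0 s)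

      cyclic⁺ : c⁺ 0 ≡ c⁺ s
      cyclic⁺ = trans (∸-balance {P 0} {A} {M 0} {K} turn) (sym (cong₂ _∸_ P-end M-end))

      cyclic⁻ : c⁻ 0 ≡ c⁻ s
      cyclic⁻ = trans (∸-balance {M 0} {K} {P 0} {A} (sym turn)) (sym (cong₂ _∸_ M-end P-end))

  below : ℕ → (ℕ → ℕ) → ℕ → ℕ
  below b g k with k <? b
  ... | yes _ = g k
  ... | no  _ = 0

  below-in : ∀ {b} g {k} → k < b → below b g k ≡ g k
  below-in {b} g {k} k<b with k <? b
  ... | yes _  = refl
  ... | no k≮b = contradiction k<b k≮b

  below-out : ∀ {b} g {k} → b ≤ k → below b g k ≡ 0
  below-out {b} g {k} b≤k with k <? b
  ... | yes k<b = contradiction b≤k (<⇒≱ k<b)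
  ... | no _    = refl

  below-cong : ∀ b {g h} → (∀ k → g k ≡ h k) → ∀ k → below b g k ≡ below b h k
  below-cong b eq k with k <? b
  ... | yes _ = eq k
  ... | no  _ = refl

  below-shift : ∀ b r g k → below (b + r) g (r + k) ≡ below b (g ∘ (r +_)) k
  below-shift b r g k with k <? b
  ... | yes k<b = below-in g (≤-trans (+-monoʳ-< r k<b) (≤-reflexive (+-comm r b)))
  ... | no  k≮b = below-out g (≤-trans (≤-reflexive (+-comm b r)) (+-monoʳ-≤ r (≮⇒≥ k≮b)))

  window : ℕ → ℕ → (ℕ → ℕ) → ℕ → ℕ
  window a b g k with a ≤? k
  ... | yes _ = below b g k
  ... | no  _ = 0

  window-below : ∀ {a b} → a ≤ b → ∀ g k → window a b g k + below a g k ≡ below b g k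
  window-below {a} {b} a≤b g k with a ≤? k
  ... | yes a≤k = trans (cong (below b g k +_) (below-out g a≤k)) (+-identityʳ _)
  ... | no  a≰k = trans (below-in g (≰⇒> a≰k)) (sym (below-in g (≤-trans (≰⇒> a≰k) a≤b)))

  window-support : ∀ a b g k → window a b g k ≡ 0 ⊎ (window a b g k ≡ g k × a ≤ k × k < b)
  window-support a b g k with a ≤? k
  ... | no  _   = inj₁ refl
  ... | yes a≤k with k <? b
  ... | yes k<b = inj₂ (refl , a≤k , k<b)
  ... | no  _   = inj₁ refl

  -- r-periodic sampling of [0, b + r) differs from that of [0, b) by exactly one sample.
  module Sample (d r j : ℕ) where
    sample : ℕ → (ℕ → ℕ) → ℕ
    sample b g = ∑ d (λ i → below b g (i * r + j))

    sample-cong : ∀ b {g h} → (∀ k → g k ≡ h k) → sample b g ≡ sample b h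
    sample-cong b eq = ∑-cong d λ i _ → below-cong b eq (i * r + j)

    window-sample : ∀ {a b} → a ≤ b → ∀ g → ∑ d (λ i → window a b g (i * r + j)) + sample a g ≡ sample b g
    window-sample a≤b g = trans (sym (∑-+ d _ _)) (∑-cong d λ i _ → window-below a≤b g (i * r + j))

  sample-shift : ∀ d r j → j < r → ∀ b g → b + r ≤ d * r →
    Sample.sample d r j (b + r) g ≡ g j + Sample.sample d r j b (g ∘ (r +_))
  sample-shift zero r j j<r b g le = contradiction (≤-trans (≤-<-trans z≤n j<r) (≤-trans (m≤n+m r b) le)) λ ()
  sample-shift (suc d) r j j<r b g le = cong₂ _+_ (below-in g (≤-trans j<r (m≤n+m r b))) (begin
    ∑ d (λ i → below (b + r) g (r + i * r + j))
      ≡⟨ ∑-cong d (λ i _ → trans (cong (below (b + r) g) (+-assoc r (i * r) j)) (below-shift b r g (i * r + j))) ⟩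
    ∑ d (λ i → below b (g ∘ (r +_)) (i * r + j))
      ≡⟨ +-identityʳ _ ⟨
    ∑ d (λ i → below b (g ∘ (r +_)) (i * r + j)) + 0
      ≡⟨ cong (∑ d (λ i → below b (g ∘ (r +_)) (i * r + j)) +_) (below-out (g ∘ (r +_)) b≤) ⟨
    ∑ d (λ i → below b (g ∘ (r +_)) (i * r + j)) + below b (g ∘ (r +_)) (d * r + j)
      ≡⟨ ∑-last d (λ i → below b (g ∘ (r +_)) (i * r + j)) ⟨
    ∑ (suc d) (λ i → below b (g ∘ (r +_)) (i * r + j)) ∎)
    where
    open ≡-Reasoning
    b≤ : b ≤ d * r + j
    b≤ = ≤-trans (+-cancelʳ-≤ r b (d * r) (≤-trans le (≤-reflexive (+-comm r (d * r))))) (m≤m+n (d * r) j)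

  sample-shift² : ∀ d r j → j < r → ∀ b g → b + 2 * r ≤ d * r → (∀ k → g (r + (r + k)) ≡ g k) →
    Sample.sample d r j (b + 2 * r) g ≡ g j + g (r + j) + Sample.sample d r j b g
  sample-shift² d r j j<r b g le per = begin
    sample (b + 2 * r) g        ≡⟨ cong (λ z → sample z g) (ring b r) ⟩
    sample (b + r + r) g        ≡⟨ sample-shift d r j j<r (b + r) g le′ ⟩
    g j + sample (b + r) (g ∘ (r +_))  ≡⟨ cong (g j +_) (sample-shift d r j j<r b (g ∘ (r +_)) (≤-trans (m≤m+n _ r) le′)) ⟩
    g j + (g (r + j) + sample b (λ k → g (r + (r + k))))  ≡⟨ +-assoc (g j) _ _ ⟨
    g j + g (r + j) + sample b (λ k → g (r + (r + k)))  ≡⟨ cong (g j + g (r + j) +_) (sample-cong b per) ⟩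
    g j + g (r + j) + sample b g  ∎
    where
    open ≡-Reasoning
    open Sample d r j
    ring : ∀ b r → b + 2 * r ≡ b + r + r
    ring = solve-∀
    le′ : b + r + r ≤ d * r
    le′ = ≤-trans (≤-reflexive (sym (ring b r))) le

  -- A stretch of `2 Rᵢ` consecutive positions meets every class modulo `Rᵢ` exactly twice, so the
  -- constant digit `h` yields `2 h = p − 1`. This is also the largest digit that `slope` admits
  -- without `ω`.
  odd-target : ∀ {h s′ R₁ d₁ R₂ d₂} → d₁ * R₁ ≡ suc s′ → d₂ * R₂ ≡ suc s′ → 2 * (R₁ + R₂ + 1) ≤ suc s′ →
    Target (h + h) s′ R₁ d₁ R₂ d₂
  odd-target {h} {s′} {R₁} {d₁} {R₂} {d₂} eq₁ eq₂ room = record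
    { e₁ = e₁ ; e₂ = e₂ ; ω = const 0
    ; disjoint = disjoint
    ; ω-bit = λ _ → inj₁ refl ; ω-start = refl ; ω-stop = refl ; ω-end = refl
    ; slope = λ k → ≤-trans (≤-trans (*-monoʳ-≤ 2 (small k)) (≤-reflexive (cong (h +_) (+-identityʳ h)))) (m≤m+n (h + h) 0)
    ; gap = gap ; gap² = λ _ _ ω≢0 → contradiction refl ω≢0
    ; e₂-stop = e₂-stop
    ; class₁ = λ j j<R → class {R₁} {d₁} eq₁ j j<R 0 (≤-trans (m≤m+n (2 * R₁) (2 * R₂)) room′)
    ; class₂ = λ j j<R → class {R₂} {d₂} eq₂ j j<R (2 * R₁) room′
    }
    where
    e₁ e₂ : ℕ → ℕ
    e₁ = window 0 (2 * R₁) (const h)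
    e₂ = window (2 * R₁) (2 * R₁ + 2 * R₂) (const h)

    ring : ∀ a b → 2 * (a + b + 1) ≡ 2 + (2 * a + 2 * b)
    ring = solve-∀

    room″ : 2 + (2 * R₁ + 2 * R₂) ≤ suc s′
    room″ = ≤-trans (≤-reflexive (sym (ring R₁ R₂))) room

    room′ : 2 * R₁ + 2 * R₂ ≤ suc s′
    room′ = ≤-trans (m≤n+m _ 2) room″

    disjoint : ∀ k → e₁ k ≡ 0 ⊎ e₂ k ≡ 0
    disjoint k with window-support 0 (2 * R₁) (const h) k | window-support (2 * R₁) (2 * R₁ + 2 * R₂) (const h) k
    ... | inj₁ e | _ = inj₁ e
    ... | inj₂ _ | inj₁ e = inj₂ e
    ... | inj₂ (_ , _ , k<) | inj₂ (_ , ≤k , _) = contradiction ≤k (<⇒≱ k<)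

    window≤ : ∀ a b k → window a b (const h) k ≤ h
    window≤ a b k with window-support a b (const h) k
    ... | inj₁ e = ≤-trans (≤-reflexive e) z≤n
    ... | inj₂ (e , _) = ≤-reflexive e

    small : ∀ k → e₁ k + e₂ k ≤ h
    small k with disjoint k
    ... | inj₁ e = ≤-trans (≤-reflexive (cong (_+ e₂ k) e)) (window≤ (2 * R₁) (2 * R₁ + 2 * R₂) k)
    ... | inj₂ e = ≤-trans (≤-reflexive (trans (cong (e₁ k +_) e) (+-identityʳ _))) (window≤ 0 (2 * R₁) k)

    gap : ∀ k → e₁ (suc k) ≢ 0 → e₂ k ≡ 0
    gap k ne with window-support 0 (2 * R₁) (const h) (suc k) | window-support (2 * R₁) (2 * R₁ + 2 * R₂) (const h) k
    ... | inj₁ e | _ = contradiction e ne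
    ... | inj₂ _ | inj₁ e = e
    ... | inj₂ (_ , _ , k<) | inj₂ (_ , ≤k , _) = contradiction ≤k (<⇒≱ (<⇒≤ k<))

    e₂-stop : e₂ s′ ≡ 0
    e₂-stop with window-support (2 * R₁) (2 * R₁ + 2 * R₂) (const h) s′
    ... | inj₁ e = e
    ... | inj₂ (_ , _ , s′<) = contradiction (≤-trans (n≤1+n _) (≤-pred room″)) (<⇒≱ s′<)

    class : ∀ {R d} → d * R ≡ suc s′ → ∀ j → j < R → ∀ b → b + 2 * R ≤ suc s′ →
      ∑ d (λ i → window b (b + 2 * R) (const h) (i * R + j)) ≡ h + h
    class {R} {d} eq j j<R b le = +-cancelʳ-≡ (sample b (const h)) _ _
      (trans (window-sample (m≤m+n b (2 * R)) (const h)) (sample-shift² d R j j<R b (const h) (≤-trans le (≤-reflexive (sym eq))) (λ _ → refl)))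
      where open Sample d R j

  -- Target digits for p = 2

  ev : ℕ → ℕ
  ev zero          = 1
  ev (suc zero)    = 0
  ev (suc (suc k)) = ev k

  od : ℕ → ℕ
  od = ev ∘ suc

  ev+od : ∀ k → ev k + od k ≡ 1
  ev+od zero          = refl
  ev+od (suc zero)    = refl
  ev+od (suc (suc k)) = ev+od k

  ev-double : ∀ m k → ev (m + m + k) ≡ ev k
  ev-double zero    k = refl
  ev-double (suc m) k = trans (cong (λ z → ev (suc (z + k))) (+-suc m m)) (ev-double m k)

  od-double : ∀ m k → od (m + m + k) ≡ od k
  od-double m k = trans (cong ev (sym (+-suc (m + m) k))) (ev-double m (suc k))

  halve : ∀ n → ∃[ m ] (n ≡ m + m ⊎ n ≡ suc (m + m))
  halve zero = 0 , inj₁ refl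
  halve (suc n) with halve n
  ... | m , inj₁ refl = m , inj₂ refl
  ... | m , inj₂ refl = suc m , inj₁ (cong suc (sym (+-suc m m)))

  -- The even numbers of a window of length l₁ and the odd numbers of one of length l₂ together
  -- represent every residue class modulo R once; l₁ and l₂ are even.
  record Split (R : ℕ) : Set where
    field
      m₁ m₂ : ℕ
    l₁ = m₁ + m₁
    l₂ = m₂ + m₂
    field
      total : l₁ + l₂ ≡ 2 * R
      class : ∀ {d} j → j < R → ∀ a b → a + l₁ ≤ d * R → b + l₂ ≤ d * R →
        ∑ d (λ i → window a (a + l₁) ev (i * R + j)) + ∑ d (λ i → window b (b + l₂) od (i * R + j)) ≡ 1

  -- For even `R` residues have a parity, and the even and the odd ones are each met by a window of
  -- length `R`. For odd `R` adding `R` changes the parity, so the even numbers among `2 R`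
  -- consecutive ones already represent every class once.
  split : ∀ R → Split R
  split R with halve R
  ... | m , inj₁ refl = record
    { m₁ = m ; m₂ = m ; total = cong (m + m +_) (sym (+-identityʳ _))
    ; class = λ {d} j j<R a b a≤ b≤ → trans (cong₂ _+_ (one d j j<R a a≤ ev (ev-double m)) (one d j j<R b b≤ od (od-double m))) (ev+od j)
    }
    where
    one : ∀ d j → j < m + m → ∀ a → a + (m + m) ≤ d * (m + m) → ∀ g → (∀ k → g (m + m + k) ≡ g k) →
      ∑ d (λ i → window a (a + (m + m)) g (i * (m + m) + j)) ≡ g j
    one d j j<R a a≤ g per = +-cancelʳ-≡ (sample a g) _ _
      (trans (window-sample (m≤m+n a (m + m)) g) (trans (sample-shift d (m + m) j j<R a g a≤) (cong (g j +_) (sample-cong a per))))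
      where open Sample d (m + m) j
  ... | m , inj₂ refl = record
    { m₁ = R ; m₂ = 0 ; total = +-assoc R R 0
    ; class = λ {d} j j<R a b a≤ _ → cong₂ _+_ (two d j j<R a a≤) (empty d j b)
    }
    where
    odd-step : ∀ k → ev (R + k) ≡ od k
    odd-step k = od-double m k
    per : ∀ k → ev (R + (R + k)) ≡ ev k
    per k = trans (cong ev (sym (+-assoc R R k))) (ev-double R k)
    two : ∀ d j → j < R → ∀ a → a + (R + R) ≤ d * R → ∑ d (λ i → window a (a + (R + R)) ev (i * R + j)) ≡ 1
    two d j j<R a a≤ = +-cancelʳ-≡ (sample a ev) _ _ (begin
      ∑ d (λ i → window a (a + (R + R)) ev (i * R + j)) + sample a ev
        ≡⟨ window-sample (m≤m+n a (R + R)) ev ⟩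
      sample (a + (R + R)) ev
        ≡⟨ cong (λ z → sample (a + (R + z)) ev) (+-identityʳ R) ⟨
      sample (a + 2 * R) ev
        ≡⟨ sample-shift² d R j j<R a ev (≤-trans (≤-reflexive (cong (λ z → a + (R + z)) (+-identityʳ R))) a≤) per ⟩
      ev j + ev (R + j) + sample a ev
        ≡⟨ cong (_+ sample a ev) (trans (cong (ev j +_) (odd-step j)) (ev+od j)) ⟩
      1 + sample a ev ∎)
      where
      open ≡-Reasoning
      open Sample d R j
    empty : ∀ d j b → ∑ d (λ i → window b (b + 0) od (i * R + j)) ≡ 0
    empty d j b = trans (∑-cong d λ i _ → vanish (i * R + j)) (zeros d)
      where
      vanish : ∀ k → window b (b + 0) od k ≡ 0
      vanish k with window-support b (b + 0) od k
      ... | inj₁ e = e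
      ... | inj₂ (_ , b≤k , k<) = contradiction b≤k (<⇒≱ (≤-trans k< (≤-reflexive (+-identityʳ b))))
      zeros : ∀ d → ∑ d (const 0) ≡ 0
      zeros zero    = refl
      zeros (suc d) = zeros d

  -- With binary digits, ω marks the positions following a digit 1.
  module EvenTarget {s′ R₁ d₁ R₂ d₂} (eq₁ : d₁ * R₁ ≡ suc s′) (eq₂ : d₂ * R₂ ≡ suc s′)
    (room : 2 * (R₁ + R₂ + 1) ≤ suc s′) where
    private
      module S₁ = Split (split R₁)
      module S₂ = Split (split R₂)
      u = S₁.l₁ + S₂.l₁
      w = u + S₁.l₂

    -- Four consecutive windows: even positions for `e₁`, then for `e₂`, odd positions for `e₁`,
    -- then for `e₂`. With all even positions before all odd ones no two ones are adjacent, and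
    -- within each parity `e₁` stays below `e₂`, as `spread` demands.
    e₁ e₂ e ω : ℕ → ℕ
    e₁ k = window 0 S₁.l₁ ev k + window u w od k
    e₂ k = window S₁.l₁ u ev k + window w (w + S₂.l₂) od k
    e k = e₁ k + e₂ k
    ω zero    = 0
    ω (suc k) = e k

    room′ : 2 + (w + S₂.l₂) ≤ suc s′
    room′ = ≤-trans (≤-reflexive (trans (ring S₁.l₁ S₂.l₁ S₁.l₂ S₂.l₂)
      (trans (cong₂ (λ y z → 2 + (y + z)) S₁.total S₂.total) (ring′ R₁ R₂)))) room
      where
      ring : ∀ a b c d → 2 + (a + b + c + d) ≡ 2 + ((a + c) + (b + d))
      ring = solve-∀
      ring′ : ∀ a b → 2 + (2 * a + 2 * b) ≡ 2 * (a + b + 1)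
      ring′ = solve-∀

    ev-u : ev u ≡ 1
    ev-u = trans (ev-double S₁.m₁ S₂.l₁) (trans (cong ev (sym (+-identityʳ S₂.l₁))) (ev-double S₂.m₁ 0))

    ev-cases : ∀ k → ev k ≡ 0 ⊎ (ev k ≡ 1 × od k ≡ 0)
    ev-cases zero          = inj₂ (refl , refl)
    ev-cases (suc zero)    = inj₁ refl
    ev-cases (suc (suc k)) = ev-cases k

    ev-od : ∀ k → ev k ≢ 0 → od k ≡ 0
    ev-od k ne with ev-cases k
    ... | inj₁ e = contradiction e ne
    ... | inj₂ (_ , e) = e

    data Place (a b c d k : ℕ) : ℕ → Set where
      outside : Place a b c d k 0
      even    : a ≤ k → k < b → ev k ≢ 0 → Place a b c d k 1
      odd     : c ≤ k → k < d → od k ≢ 0 → Place a b c d k 1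

    place : ∀ {a b c d} → b ≤ c → ∀ k → Place a b c d k (window a b ev k + window c d od k)
    place {a} {b} {c} {d} b≤c k with window-support a b ev k | window-support c d od k
    ... | inj₁ e | inj₁ e′ rewrite e | e′ = outside
    ... | inj₂ (_ , _ , k<b) | inj₂ (_ , c≤k , _) = contradiction (≤-trans b≤c c≤k) (<⇒≱ k<b)
    ... | inj₂ (e , a≤k , k<b) | inj₁ e′ rewrite e | e′ with ev-cases k
    ...   | inj₁ z rewrite z = outside
    ...   | inj₂ (o , _) rewrite o = even a≤k k<b (λ z → contradiction (trans (sym o) z) λ ())
    place {a} {b} {c} {d} b≤c k | inj₁ e | inj₂ (e′ , c≤k , k<d) rewrite e | e′ with ev-cases (suc k)
    ...   | inj₁ z rewrite z = outside
    ...   | inj₂ (o , _) rewrite o = odd c≤k k<d (λ z → contradiction (trans (sym o) z) λ ())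

    place₁ : ∀ k → Place 0 S₁.l₁ u w k (e₁ k)
    place₁ = place (m≤m+n S₁.l₁ S₂.l₁)

    place₂ : ∀ k → Place S₁.l₁ u w (w + S₂.l₂) k (e₂ k)
    place₂ = place (m≤m+n u S₁.l₂)

    exclusive : ∀ k → Place 0 u u (w + S₂.l₂) k (e k)
    exclusive k with e₁ k | place₁ k | e₂ k | place₂ k
    ... | _ | outside    | _ | outside = outside
    ... | _ | outside    | _ | even a b c = even z≤n b c
    ... | _ | outside    | _ | odd a b c = odd (≤-trans (m≤m+n u _) a) b c
    ... | _ | even a b c | _ | outside = even z≤n (≤-trans b (m≤m+n S₁.l₁ S₂.l₁)) c
    ... | _ | odd a b c  | _ | outside = odd a (≤-trans b (m≤m+n w _)) c
    ... | _ | even a b c | _ | even a′ b′ c′ = contradiction a′ (<⇒≱ b)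
    ... | _ | even a b c | _ | odd a′ b′ c′ = contradiction (ev-od k c) c′
    ... | _ | odd a b c  | _ | even a′ b′ c′ = contradiction (ev-od k c′) c
    ... | _ | odd a b c  | _ | odd a′ b′ c′ = contradiction a′ (<⇒≱ b)

    sparse : ∀ k → e k ≢ 0 → e (suc k) ≡ 0
    sparse k ne with e k | exclusive k | e (suc k) | exclusive (suc k)
    ... | _ | outside | _ | _ = contradiction refl ne
    ... | _ | _ | _ | outside = refl
    ... | _ | even a b c | _ | even a′ b′ c′ = contradiction (ev-od k c) c′
    -- The parity changes only at `u`, which is even and hence carries no odd digit.
    ... | _ | even a b c | _ | odd a′ b′ c′ = contradiction (ev-od (suc k) (λ z → contradiction (trans (sym ev-u) (trans (cong ev (≤-antisym a′ b)) z)) λ ())) c′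
    ... | _ | odd a b c | _ | even a′ b′ c′ = contradiction a (<⇒≱ (<⇒≤ b′))
    ... | _ | odd a b c | _ | odd a′ b′ c′ = contradiction (ev-od k c′) c

    spread : ∀ k → e₁ (2 + k) ≢ 0 → e₂ k ≡ 0
    spread k ne with e₁ (2 + k) | place₁ (2 + k) | e₂ k | place₂ k
    ... | _ | outside | _ | _ = contradiction refl ne
    ... | _ | _ | _ | outside = refl
    ... | _ | even a b c | _ | even a′ b′ c′ = contradiction a′ (<⇒≱ (<-trans (n<1+n k) (<⇒≤ b)))
    ... | _ | even a b c | _ | odd a′ b′ c′ = contradiction (ev-od k c) c′
    ... | _ | odd a b c  | _ | even a′ b′ c′ = contradiction (ev-od k c′) c
    ... | _ | odd a b c  | _ | odd a′ b′ c′ = contradiction a′ (<⇒≱ (<-trans (n<1+n k) (<⇒≤ b)))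

    high : ∀ k → w + S₂.l₂ ≤ k → e k ≡ 0
    high k le with e k | exclusive k
    ... | _ | outside = refl
    ... | _ | even a b c = contradiction (≤-trans (≤-trans (m≤m+n u _) (m≤m+n w _)) le) (<⇒≱ b)
    ... | _ | odd a b c = contradiction le (<⇒≱ b)

    bit : ∀ k → e k ≡ 0 ⊎ e k ≡ 1
    bit k with e k | exclusive k
    ... | _ | outside = inj₁ refl
    ... | _ | even _ _ _ = inj₂ refl
    ... | _ | odd _ _ _ = inj₂ refl

    ω-bit : ∀ k → ω k ≡ 0 ⊎ (ω k ≡ 1 × e₁ k ≡ 0 × e₂ k ≡ 0)
    ω-bit zero = inj₁ refl
    ω-bit (suc k) with bit k
    ... | inj₁ z = inj₁ z
    ... | inj₂ o = inj₂ (o , m+n≡0⇒m≡0 (e₁ (suc k)) s , m+n≡0⇒n≡0 (e₁ (suc k)) s)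
      where s = sparse k (λ z → contradiction (trans (sym o) z) λ ())

    ω-before : ∀ k → e k ≢ 0 → ω k ≡ 0
    ω-before k ne with ω-bit k
    ... | inj₁ z = z
    ... | inj₂ (_ , z , z′) = contradiction (cong₂ _+_ z z′) ne

    -- A digit 1 exceeds the allowance by one, which the mark above it repays; a marked position has
    -- digit 0 and can afford its own mark.
    slope : ∀ k → ω k + 2 * e k ≤ 1 + e k
    slope k with bit k
    ... | inj₂ o rewrite ω-before k (λ z → contradiction (trans (sym o) z) λ ()) | o = ≤-refl
    ... | inj₁ z rewrite z | +-identityʳ (ω k) with ω-bit k
    ...   | inj₁ z′ rewrite z′ = z≤n
    ...   | inj₂ (o , _) rewrite o = ≤-refl

    even-target : Target 1 s′ R₁ d₁ R₂ d₂
    even-target = record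
      { e₁ = e₁ ; e₂ = e₂ ; ω = ω
      ; disjoint = disjoint ; ω-bit = ω-bit ; ω-start = refl
      ; ω-stop = ω-stop ; ω-end = high s′ (≤-trans (n≤1+n _) (≤-pred room′))
      ; slope = slope
      ; gap = gap
      ; gap² = λ k ne ω≢0 → spread k ne , ω-before k ω≢0
      ; e₂-stop = m+n≡0⇒n≡0 (e₁ s′) (high s′ (≤-trans (n≤1+n _) (≤-pred room′)))
      ; class₁ = λ j j<R → trans (∑-+ d₁ (λ i → window 0 S₁.l₁ ev (i * R₁ + j)) _) (S₁.class {d₁} j j<R 0 u
          (≤-trans (≤-trans (m≤m+n _ _) (≤-trans (m≤m+n u _) w≤)) (≤-reflexive (sym eq₁)))
          (≤-trans w≤ (≤-reflexive (sym eq₁))))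
      ; class₂ = λ j j<R → trans (∑-+ d₂ (λ i → window S₁.l₁ u ev (i * R₂ + j)) _) (S₂.class {d₂} j j<R S₁.l₁ w
          (≤-trans (≤-trans (m≤m+n u _) w≤) (≤-reflexive (sym eq₂)))
          (≤-trans (≤-trans (m≤n+m _ 2) room′) (≤-reflexive (sym eq₂))))
      }
      where
      w≤ : w ≤ suc s′
      w≤ = ≤-trans (≤-trans (m≤m+n w S₂.l₂) (m≤n+m _ 2)) room′

      disjoint : ∀ k → e₁ k ≡ 0 ⊎ e₂ k ≡ 0
      disjoint k with bit k | e₁ k ≟ 0
      ... | _ | yes z = inj₁ z
      ... | inj₁ z | _ = inj₁ (m+n≡0⇒m≡0 (e₁ k) z)
      ... | inj₂ o | no ne with e₁ k
      ...   | zero = contradiction refl ne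
      ...   | suc x = inj₂ (m+n≡0⇒n≡0 x (suc-injective o))

      gap : ∀ k → e₁ (suc k) ≢ 0 → e₂ k ≡ 0
      gap k ne with e k ≟ 0
      ... | yes z = m+n≡0⇒n≡0 (e₁ k) z
      ... | no ne′ = contradiction (m+n≡0⇒m≡0 (e₁ (suc k)) (sparse k ne′)) ne

      -- The mark at `s′` is the digit one position below, so here both free positions at the top
      -- are used.
      ω-stop : ω s′ ≡ 0
      ω-stop = stop s′ (≤-pred room′)
        where
        stop : ∀ k → suc (w + S₂.l₂) ≤ k → ω k ≡ 0
        stop (suc k) (s≤s le) = high k le

-- Polynomial functions and the digits of their exponents

module Expansion {c ℓ N} (F : FiniteField c ℓ N) {p s} (prime : Prime p) (card : N ≡ p ℕ.^ s) where
  open FieldTheory F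
  open Characteristic {s = s} prime card
  open Relation.Binary.Reasoning.Setoid setoid
  open Algebra.Properties.CommutativeSemigroup *-commutativeSemigroup using (interchange; x∙yz≈y∙xz)
  open Targets using (val; val-+)
  private module D = Digits

  infixl 6 _⊕_
  _⊕_ : (ℕ → ℕ) → (ℕ → ℕ) → ℕ → ℕ
  (f ⊕ g) k = f k ℕ.+ g k

  weight : (ℕ → ℕ) → ℕ
  weight = D.∑ s

  -- Exponents are given by digit functions whose values may exceed `p − 1`, so that a product of
  -- monomials adds digits without carrying.
  mono : (ℕ → ℕ) → Carrier → Carrier
  mono f x = x ^ val p s f

  mono-⊕ : ∀ f g x → mono (f ⊕ g) x ≈ mono f x * mono g x
  mono-⊕ f g x = trans (^-congʳ x (val-+ p s f g)) (^-homo-* x (val p s f) (val p s g))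

  δ : ℕ → ℕ → ℕ → ℕ
  δ zero    m zero    = m
  δ zero    m (suc k) = 0
  δ (suc a) m zero    = 0
  δ (suc a) m (suc k) = δ a m k

  δ-on : ∀ a m → δ a m a ≡ m
  δ-on zero    m = ≡.refl
  δ-on (suc a) m = δ-on a m

  δ-off : ∀ a m k → a ≢ k → δ a m k ≡ 0
  δ-off zero    m zero    a≢k = contradiction ≡.refl a≢k
  δ-off zero    m (suc k) a≢k = ≡.refl
  δ-off (suc a) m zero    a≢k = ≡.refl
  δ-off (suc a) m (suc k) a≢k = δ-off a m k (a≢k ∘ cong suc)

  ∑-0 : ∀ n → D.∑ n (const 0) ≡ 0
  ∑-0 zero    = ≡.refl
  ∑-0 (suc n) = ∑-0 n

  ∑-δ : ∀ n a m (h : ℕ → ℕ) → a ℕ.< n → D.∑ n (λ k → δ a m k ℕ.* h k) ≡ m ℕ.* h a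
  ∑-δ (suc n) zero    m h _         = ≡.trans (cong (m ℕ.* h 0 ℕ.+_) (∑-0 n)) (ℕ.+-identityʳ _)
  ∑-δ (suc n) (suc a) m h (s≤s a<n) = ∑-δ n a m (h ∘ suc) a<n

  weight-δ : ∀ a m → a ℕ.< s → weight (δ a m) ≡ m
  weight-δ a m a<s = ≡.trans (D.∑-cong s λ k _ → ≡.sym (ℕ.*-identityʳ (δ a m k))) (≡.trans (∑-δ s a m (const 1) a<s) (ℕ.*-identityʳ m))

  mono-δ : ∀ a m x → a ℕ.< s → mono (δ a m) x ≈ (x ^ (p ℕ.^ a)) ^ m
  mono-δ a m x a<s = trans (^-congʳ x (≡.trans (∑-δ s a m (p ℕ.^_) a<s) (ℕ.*-comm m _))) (sym (^-assocʳ x (p ℕ.^ a) m))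

  mono-0 : ∀ x → mono (const 0) x ≈ 1#
  mono-0 x = ^-congʳ x (∑-0 s)

  -- The linear combinations are recorded inductively, which reduces a bilinear claim to pairs of
  -- monomials.
  data Span (G : (ℕ → ℕ) → Set) : (Carrier → Carrier) → Set (c ⊔ ℓ) where
    null : Span G (λ _ → 0#)
    term : ∀ κ f → G f → Span G (λ x → κ * mono f x)
    plus : ∀ {φ ψ} → Span G φ → Span G ψ → Span G (λ x → φ x + ψ x)
    resp : ∀ {φ ψ} → (∀ x → φ x ≈ ψ x) → Span G φ → Span G ψ

  span-weaken : ∀ {G H φ} → (∀ f → G f → H f) → Span G φ → Span H φ
  span-weaken G⊆H null         = null
  span-weaken G⊆H (term κ f g) = term κ f (G⊆H f g)
  span-weaken G⊆H (plus a b)   = plus (span-weaken G⊆H a) (span-weaken G⊆H b)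
  span-weaken G⊆H (resp eq a)  = resp eq (span-weaken G⊆H a)

  span-mul : ∀ {G H K φ ψ} → (∀ f g → G f → H g → K (f ⊕ g)) → Span G φ → Span H ψ → Span K (λ x → φ x * ψ x)
  span-mul GH⊆K null b = resp (λ x → sym (zeroˡ _)) null
  span-mul GH⊆K (plus a a′) b = resp (λ x → sym (distribʳ _ _ _)) (plus (span-mul GH⊆K a b) (span-mul GH⊆K a′ b))
  span-mul GH⊆K (resp eq a) b = resp (λ x → *-congʳ (eq x)) (span-mul GH⊆K a b)
  span-mul GH⊆K a@(term _ _ _) null = resp (λ x → sym (zeroʳ _)) null
  span-mul GH⊆K (term κ f g) (term κ′ f′ g′) =
    resp (λ x → trans (*-congˡ (mono-⊕ f f′ x)) (interchange κ κ′ (mono f x) (mono f′ x))) (term (κ * κ′) (f ⊕ f′) (GH⊆K f f′ g g′))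
  span-mul GH⊆K a@(term _ _ _) (plus b b′) = resp (λ x → sym (distribˡ _ _ _)) (plus (span-mul GH⊆K a b) (span-mul GH⊆K a b′))
  span-mul GH⊆K a@(term _ _ _) (resp eq b) = resp (λ x → *-congˡ (eq x)) (span-mul GH⊆K a b)

  span-scale : ∀ {G φ} κ → Span G φ → Span G (λ x → κ * φ x)
  span-scale κ null         = resp (λ x → sym (zeroʳ κ)) null
  span-scale κ (term κ′ f g) = resp (λ x → *-assoc κ κ′ _) (term (κ * κ′) f g)
  span-scale κ (plus a b)   = resp (λ x → sym (distribˡ κ _ _)) (plus (span-scale κ a) (span-scale κ b))
  span-scale κ (resp eq a)  = resp (λ x → *-congˡ (eq x)) (span-scale κ a)

  span-sum : ∀ {G n} {φ : Fin n → Carrier → Carrier} → (∀ i → Span G (φ i)) → Span G (λ x → sum (λ i → φ i x))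
  span-sum {n = zero}  spans = null
  span-sum {n = suc n} spans = plus (spans zero) (span-sum (spans ∘ suc))

  Term : (ℕ → Set) → ℕ → (ℕ → ℕ) → Set
  Term S n f = (∀ k → ¬ S k → f k ≡ 0) × weight f ℕ.≤ n

  Off : (ℕ → Set) → (ℕ → ℕ) → (ℕ → ℕ) → Set
  Off S e f = ∃[ k ] S k × k ℕ.< s × f k ≢ e k

  Other : (ℕ → Set) → ℕ → (ℕ → ℕ) → (ℕ → ℕ) → Set
  Other S n e f = Term S n f × Off S e f

  -- φ is a polynomial with digits supported in S, of digit sum at most n, in which the monomial
  -- whose digits on S are those of e has a nonzero coefficient.
  record Leading (S : ℕ → Set) (n : ℕ) (e : ℕ → ℕ) (φ : Carrier → Carrier) : Set (c ⊔ ℓ) where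
    constructor leading
    field
      κ       : Carrier
      g       : ℕ → ℕ
      ψ       : Carrier → Carrier
      κ≉0     : κ ≉ 0#
      g-term  : Term S n g
      g-agree : ∀ k → S k → k ℕ.< s → g k ≡ e k
      others  : Span (Other S n e) ψ
      split   : ∀ x → φ x ≈ κ * mono g x + ψ x

    span : Span (Term S n) φ
    span = resp (λ x → sym (split x)) (plus (term κ g g-term) (span-weaken (λ _ → proj₁) others))

  leading-resp : ∀ {S n e φ φ′} → (∀ x → φ x ≈ φ′ x) → Leading S n e φ → Leading S n e φ′
  leading-resp eq (leading κ g ψ κ≉0 t a o sp) = leading κ g ψ κ≉0 t a o (λ x → trans (sym (eq x)) (sp x))

  leading-plus : ∀ {S n e φ ψ} → Leading S n e φ → Span (Other S n e) ψ → Leading S n e (λ x → φ x + ψ x)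
  leading-plus (leading κ g ψ κ≉0 t a o sp) b =
    leading κ g _ κ≉0 t a (plus o b) (λ x → trans (+-congʳ (sp x)) (+-assoc _ _ _))

  leading-scale : ∀ {S n e φ} κ → κ ≉ 0# → Leading S n e φ → Leading S n e (λ x → κ * φ x)
  leading-scale κ κ≉0 (leading κ′ g ψ κ′≉0 t a o sp) =
    leading (κ * κ′) g _ (*-≉0 κ≉0 κ′≉0) t a (span-scale κ o)
      (λ x → trans (*-congˡ (sp x)) (trans (distribˡ κ _ _) (+-congʳ (sym (*-assoc κ κ′ _)))))

  leading-resize : ∀ {S S′ n e φ} → (∀ k → S k → S′ k) → (∀ k → k ℕ.< s → S′ k → S k) →
    Leading S n e φ → Leading S′ n e φ
  leading-resize {S} {S′} {n} to from (leading κ g ψ κ≉0 t a o sp) =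
    leading κ g ψ κ≉0 (grow g t) (λ k S′k k<s → a k (from k k<s S′k) k<s)
      (span-weaken (λ f (t , k , Sk , rest) → grow f t , k , to k Sk , rest) o) sp
    where
    grow : ∀ f → Term S n f → Term S′ n f
    grow f (off , w) = (λ k ¬S′k → off k (¬S′k ∘ to k)) , w

  term-⊕ : ∀ {S S′ : ℕ → Set} {n n′} f f′ → Term S n f → Term S′ n′ f′ → Term (λ k → S k ⊎ S′ k) (n ℕ.+ n′) (f ⊕ f′)
  term-⊕ f f′ (off , w) (off′ , w′) =
    (λ k ¬SS′ → cong₂ ℕ._+_ (off k (¬SS′ ∘ inj₁)) (off′ k (¬SS′ ∘ inj₂))) ,
    ℕ.≤-trans (ℕ.≤-reflexive (D.∑-+ s f f′)) (ℕ.+-mono-≤ w w′)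

  -- On disjoint supports the digits of a product determine those of its factors, so the leading
  -- monomial arises only from the two leading monomials.
  leading-mul : ∀ {S S′ n n′ e φ φ′} → (∀ k → S k → ¬ S′ k) → Leading S n e φ → Leading S′ n′ e φ′ →
    Leading (λ k → S k ⊎ S′ k) (n ℕ.+ n′) e (λ x → φ x * φ′ x)
  leading-mul {S} {S′} {n} {n′} {e} {φ} {φ′} disjoint L@(leading κ g ψ κ≉0 t a o sp) L′@(leading κ′ g′ ψ′ κ′≉0 t′ a′ o′ sp′) =
    leading (κ * κ′) (g ⊕ g′) _ (*-≉0 κ≉0 κ′≉0) (term-⊕ g g′ t t′) agree
      (plus (span-mul right (term κ g t) o′) (span-mul left o (Leading.span L′)))
      (λ x → begin
        φ x * φ′ x
          ≈⟨ *-congʳ (sp x) ⟩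
        (κ * mono g x + ψ x) * φ′ x
          ≈⟨ distribʳ _ _ _ ⟩
        κ * mono g x * φ′ x + ψ x * φ′ x
          ≈⟨ +-congʳ (trans (*-congˡ (sp′ x)) (distribˡ _ _ _)) ⟩
        κ * mono g x * (κ′ * mono g′ x) + κ * mono g x * ψ′ x + ψ x * φ′ x
          ≈⟨ +-assoc _ _ _ ⟩
        κ * mono g x * (κ′ * mono g′ x) + (κ * mono g x * ψ′ x + ψ x * φ′ x)
          ≈⟨ +-congʳ (trans (interchange κ (mono g x) κ′ (mono g′ x)) (*-congˡ (sym (mono-⊕ g g′ x)))) ⟩
        κ * κ′ * mono (g ⊕ g′) x + (κ * mono g x * ψ′ x + ψ x * φ′ x) ∎)
    where
    agree : ∀ k → S k ⊎ S′ k → k ℕ.< s → (g ⊕ g′) k ≡ e k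
    agree k (inj₁ Sk)  k<s = ≡.trans (cong (g k ℕ.+_) (proj₁ t′ k (disjoint k Sk))) (≡.trans (ℕ.+-identityʳ _) (a k Sk k<s))
    agree k (inj₂ S′k) k<s = ≡.trans (cong (ℕ._+ g′ k) (proj₁ t k (λ Sk → disjoint k Sk S′k))) (a′ k S′k k<s)

    right : ∀ f f′ → Term S n f → Other S′ n′ e f′ → Other (λ k → S k ⊎ S′ k) (n ℕ.+ n′) e (f ⊕ f′)
    right f f′ tf (tf′ , k , S′k , k<s , ne) = term-⊕ f f′ tf tf′ , k , inj₂ S′k , k<s ,
      λ eq → ne (≡.trans (cong (ℕ._+ f′ k) (≡.sym (proj₁ tf k (λ Sk → disjoint k Sk S′k)))) eq)

    left : ∀ f f′ → Other S n e f → Term S′ n′ f′ → Other (λ k → S k ⊎ S′ k) (n ℕ.+ n′) e (f ⊕ f′)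
    left f f′ (tf , k , Sk , k<s , ne) tf′ = term-⊕ f f′ tf tf′ , k , inj₁ Sk , k<s ,
      λ eq → ne (≡.trans (≡.sym (≡.trans (cong (f k ℕ.+_) (proj₁ tf′ k (disjoint k Sk))) (ℕ.+-identityʳ _))) eq)

  leading-one : ∀ {S e n} → (∀ k → ¬ S k) → Leading S n e (λ _ → 1#)
  leading-one empty = leading 1# (const 0) (λ _ → 0#) 1≉0 ((λ _ _ → ≡.refl) , ℕ.≤-trans (ℕ.≤-reflexive (∑-0 s)) z≤n)
    (λ k Sk → contradiction Sk (empty k)) null
    (λ x → sym (trans (+-identityʳ _) (trans (*-identityˡ _) (mono-0 x))))

  span-one : ∀ {S n} → Span (Term S n) (λ _ → 1#)
  span-one = resp (λ x → trans (*-identityˡ _) (mono-0 x))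
    (term 1# (const 0) ((λ _ _ → ≡.refl) , ℕ.≤-trans (ℕ.≤-reflexive (∑-0 s)) z≤n))

  span-power : ∀ {S φ} → Span (Term S 1) φ → ∀ m → Span (Term S m) (λ x → φ x ^ m)
  span-power sp zero    = span-one
  span-power sp (suc m) = span-mul (λ f f′ t t′ → (λ k ¬S → cong₂ ℕ._+_ (proj₁ t k ¬S) (proj₁ t′ k ¬S)) ,
    ℕ.≤-trans (ℕ.≤-reflexive (D.∑-+ s f f′)) (ℕ.+-mono-≤ (proj₂ t) (proj₂ t′))) sp (span-power sp m)

  total : ∀ d → (Fin d → ℕ) → ℕ
  total zero    h = 0
  total (suc d) h = h zero ℕ.+ total d (h ∘ suc)

  additive : ∀ {d} → (Fin d → ℕ) → Carrier → Carrier → Carrier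
  additive π z x = sum (λ i → x ^ (p ℕ.^ π i)) + z

  In : ∀ {d} → (Fin d → ℕ) → ℕ → Set
  In π k = ∃[ i ] π i ≡ k

  term-δ : ∀ {S : ℕ → Set} a m → S a → a ℕ.< s → Term S m (δ a m)
  term-δ {S} a m Sa a<s = (λ k ¬Sk → δ-off a m k (λ a≡k → ¬Sk (subst S a≡k Sa))) , ℕ.≤-reflexive (weight-δ a m a<s)

  span-additive : ∀ {d} (π : Fin d → ℕ) z → (∀ i → π i ℕ.< s) → Span (Term (In π) 1) (additive π z)
  span-additive π z π<s = plus
    (span-sum λ i → resp (λ x → trans (*-identityˡ _) (trans (mono-δ (π i) 1 x (π<s i)) (*-identityʳ _)))
      (term 1# (δ (π i) 1) (term-δ (π i) 1 (i , ≡.refl) (π<s i))))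
    (resp (λ x → *-identityʳ z) (span-scale z span-one))

  -- The coefficient of ∏ yᵢ^eᵢ in (∑ yᵢ + z)^(∑ eᵢ) is multinomial, nonzero when ∑ eᵢ < p.
  leading-power : ∀ {d} (π : Fin d → ℕ) z e → (∀ i → π i ℕ.< s) → (∀ i j → π i ≡ π j → i ≡ j) →
    total d (e ∘ π) ℕ.< p → Leading (In π) (total d (e ∘ π)) e (λ x → additive π z x ^ total d (e ∘ π))
  leading-power {zero}  π z e π<s inj n<p = leading-one λ k ()
  leading-power {suc d} π z e π<s inj n<p = leading-resp (λ x → sym (binomial x)) (leading-plus main rest)
    where
    n₀ = e (π zero)
    n′ = total d (e ∘ π ∘ suc)
    n = n₀ ℕ.+ n′
    Y : Carrier → Carrier
    Y = additive (π ∘ suc) z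
    y : Carrier → Carrier
    y x = x ^ (p ℕ.^ π zero)

    open Algebra.Properties.CommutativeSemiring.Binomial commutativeSemiring using (theorem; binomialTerm)
    -- The binomial term in which position `π zero` receives the digit prescribed by `e`.
    i₀ : Fin (suc n)
    i₀ = fromℕ< (s≤s (ℕ.m≤m+n n₀ n′))
    t : Carrier → Fin (suc n) → Carrier
    t x = binomialTerm (y x) (Y x) n

    toℕ-i₀ : toℕ i₀ ≡ n₀
    toℕ-i₀ = Fin.toℕ-fromℕ< _

    binomial : ∀ x → additive π z x ^ n ≈ t x i₀ + sum (λ j → t x (punchIn i₀ j))
    binomial x = trans (^-congˡ n (+-assoc _ _ _)) (trans (theorem n (y x) (Y x)) (sum-remove {i = i₀} (t x)))

    κ = (n C n₀) ⊗ 1#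

    first : Leading (π zero ≡_) n₀ e (λ x → y x ^ n₀)
    first = leading 1# (δ (π zero) n₀) (λ _ → 0#) 1≉0 (term-δ (π zero) n₀ ≡.refl (π<s zero))
      (λ { k ≡.refl _ → δ-on (π zero) n₀ }) null
      (λ x → sym (trans (+-identityʳ _) (trans (*-identityˡ _) (mono-δ (π zero) n₀ x (π<s zero)))))

    cons : ∀ k → π zero ≡ k ⊎ In (π ∘ suc) k → In π k
    cons k (inj₁ eq)       = zero , eq
    cons k (inj₂ (i , eq)) = suc i , eq

    uncons : ∀ k → k ℕ.< s → In π k → π zero ≡ k ⊎ In (π ∘ suc) k
    uncons k _ (zero , eq)  = inj₁ eq
    uncons k _ (suc i , eq) = inj₂ (i , eq)

    fresh : ∀ k → π zero ≡ k → ¬ In (π ∘ suc) k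
    fresh k eq (i , eq′) = contradiction (inj zero (suc i) (≡.trans eq (≡.sym eq′))) λ ()

    main : Leading (In π) n e (λ x → t x i₀)
    main = leading-resp
      (λ x → begin
        κ * (y x ^ n₀ * Y x ^ n′)                  ≈⟨ ×-assoc-* (n C n₀) 1# _ ⟩
        (n C n₀) ⊗ (1# * (y x ^ n₀ * Y x ^ n′))    ≈⟨ ×-congʳ (n C n₀) (*-identityˡ _) ⟩
        (n C n₀) ⊗ (y x ^ n₀ * Y x ^ n′)           ≈⟨ ×-cong (cong (n C_) (≡.sym toℕ-i₀))
                                                        (*-cong (^-congʳ (y x) (≡.sym toℕ-i₀))
                                                          (^-congʳ (Y x) (≡.trans (≡.sym (ℕ.m+n∸m≡n n₀ n′)) (cong (n ℕ.∸_) (≡.sym toℕ-i₀))))) ⟩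
        t x i₀                                     ∎)
      (leading-scale κ (⊗-∤ (Binomials.prime∤C prime n n₀ (ℕ.m≤m+n n₀ n′) n<p))
        (leading-resize cons uncons (leading-mul fresh first
          (leading-power (π ∘ suc) z e (π<s ∘ suc) (λ i j eq → Fin.suc-injective (inj (suc i) (suc j) eq)) (ℕ.≤-<-trans (ℕ.m≤n+m n′ n₀) n<p)))))

    rest : Span (Other (In π) n e) (λ x → sum (λ j → t x (punchIn i₀ j)))
    rest = span-sum λ j → summand (punchIn i₀ j) (Fin.punchInᵢ≢i i₀ j)
      where
      summand : ∀ i → i ≢ i₀ → Span (Other (In π) n e) (λ x → t x i)
      summand i i≢ = resp (λ x → trans (×-assoc-* (n C k) 1# _) (×-congʳ (n C k) (*-identityˡ _)))
        (span-scale ((n C k) ⊗ 1#) (span-mul other (resp (λ x → trans (*-identityˡ _) (mono-δ (π zero) k x (π<s zero))) (term 1# (δ (π zero) k) ≡.refl))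
          (span-power (span-additive (π ∘ suc) z (π<s ∘ suc)) (n ℕ.∸ k))))
        where
        k = toℕ i
        other : ∀ f f′ → f ≡ δ (π zero) k → Term (In (π ∘ suc)) (n ℕ.∸ k) f′ → Other (In π) n e (f ⊕ f′)
        other _ f′ ≡.refl t′ =
          ((λ a ¬In → cong₂ ℕ._+_ (δ-off (π zero) k a (λ eq → ¬In (zero , eq))) (proj₁ t′ a (λ (b , eq) → ¬In (suc b , eq)))) ,
            ℕ.≤-trans (ℕ.≤-reflexive (D.∑-+ s (δ (π zero) k) f′))
              (ℕ.≤-trans (ℕ.+-mono-≤ (ℕ.≤-reflexive (weight-δ (π zero) k (π<s zero))) (proj₂ t′))
                (ℕ.≤-reflexive (ℕ.m+[n∸m]≡n (ℕ.≤-pred (Fin.toℕ<n i)))))) ,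
          -- Any other binomial term already has a wrong digit at `π zero`, a position that does not
          -- occur in `Y`.
          π zero , (zero , ≡.refl) , π<s zero ,
          λ eq → i≢ (Fin.toℕ-injective (≡.trans (≡.sym (ℕ.+-identityʳ k)) (≡.trans
            (cong₂ ℕ._+_ (≡.sym (δ-on (π zero) k)) (≡.sym (proj₁ t′ (π zero) (fresh (π zero) ≡.refl)))) (≡.trans eq (≡.sym toℕ-i₀)))))

  -- Traces and their indicator polynomials

  -- For w in the subfield with p^R elements, w^(p^R − 1) written as a product over the base-p digits of p^R − 1.
  norm : Carrier → ℕ → Carrier
  norm w zero    = 1#
  norm w (suc J) = norm w J * (w ^ (p ℕ.^ J)) ^ ℕ.pred p

  norm-* : ∀ w J → w * norm w J ≈ w ^ (p ℕ.^ J)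
  norm-* w zero    = refl
  norm-* w (suc J) = begin
    w * (norm w J * v ^ ℕ.pred p)  ≈⟨ *-assoc _ _ _ ⟨
    w * norm w J * v ^ ℕ.pred p    ≈⟨ *-congʳ (norm-* w J) ⟩
    v ^ suc (ℕ.pred p)             ≈⟨ ^-congʳ v (ℕ.suc-pred p {{prime⇒nonZero prime}}) ⟩
    v ^ p                          ≈⟨ ^-assocʳ w (p ℕ.^ J) p ⟩
    w ^ (p ℕ.^ J ℕ.* p)            ≈⟨ ^-congʳ w (ℕ.*-comm (p ℕ.^ J) p) ⟩
    w ^ (p ℕ.^ suc J)              ∎
    where v = w ^ (p ℕ.^ J)

  norm≈1 : ∀ {w} R → w ≉ 0# → w ^ (p ℕ.^ R) ≈ w → norm w R ≈ 1#
  norm≈1 {w} R w≉0 fixed = *-cancel w≉0 (trans (norm-* w R) (trans fixed (sym (*-identityʳ w))))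

  module Trace (d R : ℕ) .{{_ : NonZero R}} (dR≡s : d ℕ.* R ≡ s) where
    trace : Carrier → Carrier
    trace x = sum {d} (λ i → x ^ (p ℕ.^ (toℕ i ℕ.* R)))

    trace-cong : ∀ {x y} → x ≈ y → trace x ≈ trace y
    trace-cong x≈y = sum-cong-≋ {d} λ i → ^-congˡ (p ℕ.^ (toℕ i ℕ.* R)) x≈y

    -- Raising to the power `p ^ R` rotates the terms; the last one wraps around since `x ^ N ≈ x`.
    trace-fixed : ∀ x → trace x ^ (p ℕ.^ R) ≈ trace x
    trace-fixed x = begin
      trace x ^ (p ℕ.^ R)                                    ≈⟨ frobenius^-sum R {d} _ ⟩
      sum {d} (λ i → (x ^ (p ℕ.^ (toℕ i ℕ.* R))) ^ (p ℕ.^ R)) ≈⟨ sum-cong-≋ {d} (λ i → trans (^-assocʳ x (p ℕ.^ (toℕ i ℕ.* R)) (p ℕ.^ R)) (^-congʳ x (≡.trans (≡.sym (ℕ.^-distribˡ-+-* p (toℕ i ℕ.* R) R)) (cong (p ℕ.^_) (ℕ.+-comm (toℕ i ℕ.* R) R))))) ⟩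
      sum {d} (λ i → y (suc (toℕ i)))                        ≈⟨ rotate d (trans (*-identityʳ x) (sym (trans (^-congʳ x (≡.trans (cong (p ℕ.^_) dR≡s) (≡.sym card))) (fermat x)))) ⟩
      sum {d} (λ i → y (toℕ i))                              ∎
      where
      y : ℕ → Carrier
      y i = x ^ (p ℕ.^ (i ℕ.* R))
      rotate : ∀ d → y 0 ≈ y d → sum {d} (λ i → y (suc (toℕ i))) ≈ sum {d} (λ i → y (toℕ i))
      rotate zero    _  = refl
      rotate (suc d) eq = begin
        sum {suc d} (λ i → y (suc (toℕ i)))
          ≈⟨ sum-init-last {d} (λ i → y (suc (toℕ i))) ⟩
        sum {d} (λ i → y (suc (toℕ (inject₁ i)))) + y (suc (toℕ (fromℕ d)))
          ≡⟨ cong₂ _+_ (sum-cong-≗ {d} (λ i → cong (y ∘ suc) (Fin.toℕ-inject₁ i))) (cong (y ∘ suc) (Fin.toℕ-fromℕ d)) ⟩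
        sum {d} (λ i → y (suc (toℕ i))) + y (suc d)
          ≈⟨ +-congˡ (sym eq) ⟩
        sum {d} (λ i → y (suc (toℕ i))) + y 0
          ≈⟨ +-comm _ _ ⟩
        sum {suc d} (λ i → y (toℕ i)) ∎

    indicator : Carrier → Carrier
    indicator x = - 1# * norm (trace x - 1#) R + 1#

    indicator-≈0 : ∀ x → trace x ≉ 1# → indicator x ≈ 0#
    indicator-≈0 x T≉1 = trans (+-congʳ (trans (*-congˡ (norm≈1 R (T≉1 ∘ x-y≈0⇒x≈y) fixed)) (*-identityʳ _))) (-‿inverseˡ 1#)
      where
      fixed : (trace x - 1#) ^ (p ℕ.^ R) ≈ trace x - 1#
      fixed = trans (frobenius^-+ R _ _) (+-cong (trace-fixed x) (trans (frobenius^- R 1#) (-‿cong (1^ (p ℕ.^ R)))))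

    module _ (e : ℕ → ℕ) (class : ∀ j → j ℕ.< R → D.∑ d (λ i → e (i ℕ.* R ℕ.+ j)) ≡ ℕ.pred p) where

      π : ℕ → Fin d → ℕ
      π j i = toℕ i ℕ.* R ℕ.+ j

      π<s : ∀ {j} → j ℕ.< R → ∀ i → π j i ℕ.< s
      π<s {j} j<R i = ℕ.<-≤-trans (ℕ.+-monoʳ-< (toℕ i ℕ.* R) j<R)
        (ℕ.≤-trans (ℕ.≤-reflexive (ℕ.+-comm (toℕ i ℕ.* R) R)) (ℕ.≤-trans (ℕ.*-monoˡ-≤ R (Fin.toℕ<n i)) (ℕ.≤-reflexive dR≡s)))

      π-injective : ∀ j i i′ → π j i ≡ π j i′ → i ≡ i′
      π-injective j i i′ eq = Fin.toℕ-injective (ℕ.*-cancelʳ-≡ _ _ R (ℕ.+-cancelʳ-≡ j _ _ eq))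

      residue : ∀ {j} → j ℕ.< R → ∀ m → (m ℕ.* R ℕ.+ j) % R ≡ j
      residue {j} j<R m = ≡.trans (cong (_% R) (ℕ.+-comm (m ℕ.* R) j)) (≡.trans ([m+kn]%n≡m%n j m R) (m<n⇒m%n≡m j<R))

      total-∑ : ∀ d h → total d (h ∘ toℕ) ≡ D.∑ d h
      total-∑ zero    h = ≡.refl
      total-∑ (suc d) h = cong (h 0 ℕ.+_) (total-∑ d (h ∘ suc))

      -- By additivity of Frobenius, `(trace x − 1) ^ (p ^ j)` is a constant plus the powers of `x`
      -- at the positions congruent to `j`. The prescribed digits at these positions sum to `p − 1`,
      -- the very exponent to which it is raised, so `leading-power` applies.
      factor : ∀ j → j ℕ.< R → Leading (λ k → k % R ≡ j) (ℕ.pred p) e (λ x → ((trace x - 1#) ^ (p ℕ.^ j)) ^ ℕ.pred p)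
      factor j j<R = leading-resize (λ { k (i , ≡.refl) → residue j<R (toℕ i) }) onto
        (leading-resp (λ x → ^-congˡ (ℕ.pred p) (sym (expand x)))
          (subst (λ n → Leading (In (π j)) n e (λ x → additive (π j) ((- 1#) ^ (p ℕ.^ j)) x ^ n)) n≡
            (leading-power (π j) ((- 1#) ^ (p ℕ.^ j)) e (π<s j<R) (π-injective j)
              (ℕ.≤-<-trans (ℕ.≤-reflexive n≡) (ℕ.≤-reflexive (ℕ.suc-pred p {{prime⇒nonZero prime}}))))))
        where
        n≡ : total d (e ∘ π j) ≡ ℕ.pred p
        n≡ = ≡.trans (total-∑ d (λ i → e (i ℕ.* R ℕ.+ j))) (class j j<R)

        onto : ∀ k → k ℕ.< s → k % R ≡ j → In (π j) k
        onto k k<s eq = fromℕ< i<d , ≡.trans (cong (λ z → z ℕ.* R ℕ.+ j) (Fin.toℕ-fromℕ< i<d))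
          (≡.trans (ℕ.+-comm _ j) (≡.trans (cong (ℕ._+ k / R ℕ.* R) (≡.sym eq)) (≡.sym (m≡m%n+[m/n]*n k R))))
          where
          i<d : k / R ℕ.< d
          i<d = ℕ.*-cancelʳ-< R (k / R) d (ℕ.≤-<-trans (ℕ.≤-trans (ℕ.m≤n+m _ (k % R)) (ℕ.≤-reflexive (≡.sym (m≡m%n+[m/n]*n k R)))) (ℕ.<-≤-trans k<s (ℕ.≤-reflexive (≡.sym dR≡s))))

        expand : ∀ x → (trace x - 1#) ^ (p ℕ.^ j) ≈ additive (π j) ((- 1#) ^ (p ℕ.^ j)) x
        expand x = trans (frobenius^-+ j _ _) (+-congʳ (trans (frobenius^-sum j {d} _)
          (sum-cong-≋ {d} λ i → trans (^-assocʳ x (p ℕ.^ (toℕ i ℕ.* R)) (p ℕ.^ j)) (^-congʳ x (≡.sym (ℕ.^-distribˡ-+-* p (toℕ i ℕ.* R) j))))))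

      -- The factors for distinct `j` live on distinct residue classes, as `leading-mul` requires.
      leading-norm : ∀ J → J ℕ.≤ R → Leading (λ k → k % R ℕ.< J) (J ℕ.* ℕ.pred p) e (λ x → norm (trace x - 1#) J)
      leading-norm zero    _    = leading-one λ k ()
      leading-norm (suc J) J<R = subst (λ n → Leading (λ k → k % R ℕ.< suc J) n e (λ x → norm (trace x - 1#) (suc J))) (ℕ.+-comm _ (ℕ.pred p))
        (leading-resize join part (leading-mul apart (leading-norm J (ℕ.<⇒≤ J<R)) (factor J J<R)))
        where
        join : ∀ k → k % R ℕ.< J ⊎ k % R ≡ J → k % R ℕ.< suc J
        join k (inj₁ lt) = ℕ.m<n⇒m<1+n lt
        join k (inj₂ eq) = s≤s (ℕ.≤-reflexive eq)
        part : ∀ k → k ℕ.< s → k % R ℕ.< suc J → k % R ℕ.< J ⊎ k % R ≡ J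
        part k _ (s≤s le) = ℕ.m≤n⇒m<n∨m≡n le
        apart : ∀ k → k % R ℕ.< J → ¬ (k % R ≡ J)
        apart k lt eq = ℕ.<-irrefl eq lt

      leading-indicator : (∃[ k ] k ℕ.< s × e k ≢ 0) → Leading (const ⊤) (R ℕ.* ℕ.pred p) e indicator
      leading-indicator (k , k<s , ek≢0) = leading-plus
        (leading-scale (- 1#) -1≉0 (leading-resize _ (λ k _ _ → m%n<n k R) (leading-norm R ℕ.≤-refl)))
        -- The summand 1 has only zero digits and cannot meet the leading monomial, since `e` has a
        -- nonzero digit.
        (resp (λ x → trans (*-identityˡ _) (mono-0 x)) (term 1# (const 0)
          (((λ _ _ → ≡.refl) , ℕ.≤-trans (ℕ.≤-reflexive (∑-0 s)) z≤n) , k , tt , k<s , ek≢0 ∘ ≡.sym)))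
        where
        -1≉0 : - 1# ≉ 0#
        -1≉0 eq = 1≉0 (trans (sym (trans (+-congˡ eq) (+-identityʳ 1#))) (-‿inverseʳ 1#))

-- Digit sums by residue classes

module Rearrange where
  open Digits
  open import Data.Nat.Base
  open import Data.Nat.Properties
  open ≡

  ∑-append : ∀ m n f → ∑ (m + n) f ≡ ∑ m f + ∑ n (f ∘ (m +_))
  ∑-append zero    n f = refl
  ∑-append (suc m) n f = trans (cong (f 0 +_) (∑-append m n (f ∘ suc))) (sym (+-assoc (f 0) _ _))

  ∑-nonzero : ∀ n f → ∑ n f ≢ 0 → ∃[ k ] k < n × f k ≢ 0
  ∑-nonzero zero    f ne = contradiction refl ne
  ∑-nonzero (suc n) f ne with f 0 ≟ 0
  ... | no f0≢0 = 0 , z<s , f0≢0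
  ... | yes z with ∑-nonzero n (f ∘ suc) (ne ∘ cong₂ _+_ z)
  ...   | k , k<n , fk≢0 = suc k , s<s k<n , fk≢0

  -- Every k < d * R is i * R + j for one j < R and one i < d.
  ∑-classes : ∀ d R a f → (∀ j → j < R → ∑ d (λ i → f (i * R + j)) ≡ a) → ∑ (d * R) f ≡ R * a
  ∑-classes d R a f class = trans (rows d f) (trans (∑-cong R class) (constant R))
    where
    constant : ∀ n → ∑ n (const a) ≡ n * a
    constant zero    = refl
    constant (suc n) = cong (a +_) (constant n)
    zeros : ∀ n → 0 ≡ ∑ n (const 0)
    zeros zero    = refl
    zeros (suc n) = zeros n
    rows : ∀ d f → ∑ (d * R) f ≡ ∑ R (λ j → ∑ d (λ i → f (i * R + j)))
    rows zero    f = zeros R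
    rows (suc d) f = begin
      ∑ (R + d * R) f                                            ≡⟨ ∑-append R (d * R) f ⟩
      ∑ R f + ∑ (d * R) (f ∘ (R +_))                             ≡⟨ cong (∑ R f +_) (rows d (f ∘ (R +_))) ⟩
      ∑ R f + ∑ R (λ j → ∑ d (λ i → f (R + (i * R + j))))        ≡⟨ ∑-+ R f _ ⟨
      ∑ R (λ j → f j + ∑ d (λ i → f (R + (i * R + j))))          ≡⟨ ∑-cong R (λ j _ → cong (f j +_) (∑-cong d (λ i _ → cong f (sym (+-assoc R (i * R) j))))) ⟩
      ∑ R (λ j → f j + ∑ d (λ i → f (R + i * R + j)))            ∎
      where open ≡-Reasoning

-- Extracting one coefficient of the product of the indicators

module Intersection {c ℓ N} (F : FiniteField c ℓ N) {π s′} (prime : Prime (suc π)) (card : N ≡ suc π ℕ.^ suc s′)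
  {d₁ R₁ d₂ R₂} .{{_ : NonZero R₁}} .{{_ : NonZero R₂}} (eq₁ : d₁ ℕ.* R₁ ≡ suc s′) (eq₂ : d₂ ℕ.* R₂ ≡ suc s′)
  (T : Targets.Target π s′ R₁ d₁ R₂ d₂) {μ} (N≡2+μ : N ≡ 2 ℕ.+ μ)
  (α : FiniteField.Carrier F) (α≉0 : FiniteField._≉_ F α (FiniteField.0# F)) where

  open FieldTheory F
  open Expansion F {suc π} {suc s′} prime card
  open Relation.Binary.Reasoning.Setoid setoid
  open Algebra.Properties.CommutativeSemigroup *-commutativeSemigroup using (interchange; x∙yz≈y∙xz)
  open Targets.Target T using (e₁; e₂; class₁; class₂)
  private
    module T₁ = Trace d₁ R₁ eq₁
    module T₂ = Trace d₂ R₂ eq₂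
    v = Targets.val (suc π) (suc s′)

    1≤π : 1 ℕ.≤ π
    1≤π = ℕ.≤-pred (ℕ.nonTrivial⇒n>1 (suc π) {{prime⇒nonTrivial prime}})

    -- Modulo `suc μ` this is `v e₂ − v e₁`, so `x ^ M` moves the monomial sought to an exponent
    -- divisible by `N − 1`, where the power sum is nonzero.
    M : ℕ
    M = μ ℕ.* v e₁ ℕ.+ v e₂

    exponent : (ℕ → ℕ) → (ℕ → ℕ) → ℕ
    exponent f h = M ℕ.+ (v f ℕ.+ μ ℕ.* v h)

  -- Since x^(N−2) = 1/x, this extracts the coefficient of x^(v e₁ − v e₂) from φ(x) ψ(α/x).
  ⟪_,_⟫ : (Carrier → Carrier) → (Carrier → Carrier) → Carrier → Carrier
  ⟪ φ , ψ ⟫ x = x ^ M * (φ x * ψ (α * x ^ μ))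

  B : (Carrier → Carrier) → (Carrier → Carrier) → Carrier
  B φ ψ = ∑all ⟪ φ , ψ ⟫

  B-+ˡ : ∀ φ φ′ ψ → B (λ x → φ x + φ′ x) ψ ≈ B φ ψ + B φ′ ψ
  B-+ˡ φ φ′ ψ = trans (∑all-cong {⟪ (λ x → φ x + φ′ x) , ψ ⟫} {λ x → ⟪ φ , ψ ⟫ x + ⟪ φ′ , ψ ⟫ x}
    λ x → trans (*-congˡ (distribʳ _ _ _)) (distribˡ _ _ _)) (∑all-+ ⟪ φ , ψ ⟫ ⟪ φ′ , ψ ⟫)

  B-+ʳ : ∀ φ ψ ψ′ → B φ (λ x → ψ x + ψ′ x) ≈ B φ ψ + B φ ψ′
  B-+ʳ φ ψ ψ′ = trans (∑all-cong {⟪ φ , (λ x → ψ x + ψ′ x) ⟫} {λ x → ⟪ φ , ψ ⟫ x + ⟪ φ , ψ′ ⟫ x}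
    λ x → trans (*-congˡ (distribˡ _ _ _)) (distribˡ _ _ _)) (∑all-+ ⟪ φ , ψ ⟫ ⟪ φ , ψ′ ⟫)

  B-cong : ∀ {φ φ′ ψ ψ′} → (∀ x → φ x ≈ φ′ x) → (∀ x → ψ x ≈ ψ′ x) → B φ ψ ≈ B φ′ ψ′
  B-cong {φ} {φ′} {ψ} {ψ′} eq eq′ = ∑all-cong {⟪ φ , ψ ⟫} {⟪ φ′ , ψ′ ⟫} λ x → *-congˡ (*-cong (eq x) (eq′ _))

  B-≈0 : ∀ φ ψ → (∀ x → ⟪ φ , ψ ⟫ x ≈ 0#) → B φ ψ ≈ 0#
  B-≈0 φ ψ ≈0 = trans (∑all-cong {⟪ φ , ψ ⟫} {λ _ → 0#} ≈0) (sum-replicate-zero N)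

  B-mono : ∀ κ f κ′ h → B (λ x → κ * mono f x) (λ x → κ′ * mono h x) ≈ κ * (κ′ * α ^ v h) * ∑all (_^ exponent f h)
  B-mono κ f κ′ h = trans (∑all-cong pointwise) (sym (∑all-scale (κ * (κ′ * α ^ v h)) (_^ exponent f h)))
    where
    pointwise : ∀ x → x ^ M * (κ * mono f x * (κ′ * mono h (α * x ^ μ))) ≈ κ * (κ′ * α ^ v h) * x ^ exponent f h
    pointwise x = begin
      x ^ M * (κ * x ^ v f * (κ′ * (α * x ^ μ) ^ v h))
        ≈⟨ *-congˡ (*-congˡ (*-congˡ (trans (^-distrib-* α (x ^ μ) (v h)) (*-congˡ (^-assocʳ x μ (v h)))))) ⟩
      x ^ M * (κ * x ^ v f * (κ′ * (α ^ v h * x ^ (μ ℕ.* v h))))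
        ≈⟨ *-congˡ (*-congˡ (sym (*-assoc _ _ _))) ⟩
      x ^ M * (κ * x ^ v f * (κ′ * α ^ v h * x ^ (μ ℕ.* v h)))
        ≈⟨ *-congˡ (interchange κ (x ^ v f) (κ′ * α ^ v h) (x ^ (μ ℕ.* v h))) ⟩
      x ^ M * (κ * (κ′ * α ^ v h) * (x ^ v f * x ^ (μ ℕ.* v h)))
        ≈⟨ x∙yz≈y∙xz (x ^ M) (κ * (κ′ * α ^ v h)) _ ⟩
      κ * (κ′ * α ^ v h) * (x ^ M * (x ^ v f * x ^ (μ ℕ.* v h)))
        ≈⟨ *-congˡ (trans (*-congˡ (sym (^-homo-* x (v f) (μ ℕ.* v h)))) (sym (^-homo-* x M _))) ⟩
      κ * (κ′ * α ^ v h) * x ^ exponent f h ∎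

  pred-N : ℕ.pred N ≡ suc μ
  pred-N = cong ℕ.pred N≡2+μ

  -- By bilinearity only pairs of monomials matter, and each contributes a power sum whose exponent
  -- is not a multiple of `N − 1`.
  B-vanish : ∀ {G H φ ψ} → (∀ f h → G f → H h → ¬ (suc μ ∣ exponent f h)) → Span G φ → Span H ψ → B φ ψ ≈ 0#
  B-vanish {ψ = ψ} sep null sp = B-≈0 (λ _ → 0#) ψ λ x → trans (*-congˡ (zeroˡ _)) (zeroʳ (x ^ M))
  B-vanish {ψ = ψ} sep (plus {φ} {φ′} a b) sp =
    trans (B-+ˡ φ φ′ ψ) (trans (+-cong (B-vanish sep a sp) (B-vanish sep b sp)) (+-identityˡ 0#))
  B-vanish {ψ = ψ} sep (resp {φ} {φ′} eq a) sp =
    trans (B-cong {φ′} {φ} {ψ} {ψ} (λ x → sym (eq x)) (λ _ → refl)) (B-vanish sep a sp)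
  B-vanish {φ = φ} sep (term κ f g) null = B-≈0 φ (λ _ → 0#) λ x → trans (*-congˡ (zeroʳ _)) (zeroʳ (x ^ M))
  B-vanish {φ = φ} sep a@(term _ _ _) (plus {ψ} {ψ′} b b′) =
    trans (B-+ʳ φ ψ ψ′) (trans (+-cong (B-vanish sep a b) (B-vanish sep a b′)) (+-identityˡ 0#))
  B-vanish {φ = φ} sep a@(term κ f _) (resp {ψ} {ψ′} eq b) =
    trans (B-cong {φ} {φ} {ψ′} {ψ} (λ _ → refl) (λ x → sym (eq x))) (B-vanish sep a b)
  B-vanish sep (term κ f g) (term κ′ h g′) = trans (B-mono κ f κ′ h) (trans
    (*-congˡ (power-sum-vanishes (exponent f h) (sep f h g g′ ∘ subst (_∣ exponent f h) pred-N))) (zeroʳ _))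

  weight-class : ∀ d {R} e → d ℕ.* R ≡ suc s′ →
    (∀ j → j ℕ.< R → Digits.∑ d (λ i → e (i ℕ.* R ℕ.+ j)) ≡ π) → weight e ≡ R ℕ.* π
  weight-class d {R} e dR class = ≡.trans (cong (λ n → Digits.∑ n e) (≡.sym dR)) (Rearrange.∑-classes d R π e class)

  nonzero-digit : ∀ d {R} e .{{_ : NonZero R}} → d ℕ.* R ≡ suc s′ →
    (∀ j → j ℕ.< R → Digits.∑ d (λ i → e (i ℕ.* R ℕ.+ j)) ≡ π) → ∃[ k ] k ℕ.< suc s′ × e k ≢ 0
  nonzero-digit d {R} e dR class = Rearrange.∑-nonzero (suc s′) e λ z →
    ℕ.≢-nonZero⁻¹ (R ℕ.* π) {{ℕ.m*n≢0 R π {{it}} {{ℕ.>-nonZero 1≤π}}}} (≡.trans (≡.sym (weight-class d e dR class)) z)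

  v≢0 : ∀ e → (∃[ k ] k ℕ.< suc s′ × e k ≢ 0) → v e ≢ 0
  v≢0 e (k , k<s , ek≢0) z = ek≢0 (ℕ.m*n≡0⇒m≡0 (e k) (suc π ℕ.^ k) {{ℕ.m^n≢0 (suc π) k}} (Digits.∑-zero (suc s′) (λ k → e k ℕ.* suc π ℕ.^ k) z k k<s))

  -- The product of the two indicators has a nonzero coefficient, so it is not identically zero off 0.
  indicators-meet : ¬ (∀ x → x ≉ 0# → T₁.indicator x * T₂.indicator (α * x ^ μ) ≈ 0#)
  indicators-meet vanish = *-≉0
    (*-≉0 L₁.κ≉0 (*-≉0 L₂.κ≉0 (^-≉0 (v L₂.g) α≉0)))
    (power-sum≉0 (exponent L₁.g L₂.g) {{exponent≢0}} (subst (_∣ exponent L₁.g L₂.g) (≡.sym pred-N) leading-∣))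
    (begin
      L₁.κ * (L₂.κ * α ^ v L₂.g) * ∑all (_^ exponent L₁.g L₂.g)
        ≈⟨ B-mono L₁.κ L₁.g L₂.κ L₂.g ⟨
      B φ₁ φ₂
        ≈⟨ trans (+-identityʳ _) (+-identityʳ _) ⟨
      B φ₁ φ₂ + 0# + 0#
        -- By `rigid`, no pair other than that of the two leading monomials reaches an exponent
        -- divisible by `suc μ`.
        ≈⟨ +-cong (+-congˡ (B-vanish others₂ (term L₁.κ L₁.g L₁.g-term) L₂.others)) (B-vanish others₁ L₁.others L₂.span) ⟨
      B φ₁ φ₂ + B φ₁ L₂.ψ + B L₁.ψ T₂.indicator
        ≈⟨ +-congʳ (B-+ʳ φ₁ φ₂ L₂.ψ) ⟨
      B φ₁ (λ x → φ₂ x + L₂.ψ x) + B L₁.ψ T₂.indicator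
        ≈⟨ +-congʳ (B-cong {φ₁} {φ₁} {T₂.indicator} {λ x → φ₂ x + L₂.ψ x} (λ _ → refl) L₂.split) ⟨
      B φ₁ T₂.indicator + B L₁.ψ T₂.indicator
        ≈⟨ B-+ˡ φ₁ L₁.ψ T₂.indicator ⟨
      B (λ x → φ₁ x + L₁.ψ x) T₂.indicator
        ≈⟨ B-cong {T₁.indicator} {λ x → φ₁ x + L₁.ψ x} {T₂.indicator} {T₂.indicator} L₁.split (λ _ → refl) ⟨
      B T₁.indicator T₂.indicator
        ≈⟨ B-≈0 T₁.indicator T₂.indicator pointwise ⟩
      0# ∎)
    where
    digit₁ = nonzero-digit d₁ e₁ eq₁ class₁
    digit₂ = nonzero-digit d₂ e₂ eq₂ class₂
    module L₁ = Leading (T₁.leading-indicator e₁ class₁ digit₁)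
    module L₂ = Leading (T₂.leading-indicator e₂ class₂ digit₂)
    φ₁ φ₂ : Carrier → Carrier
    φ₁ x = L₁.κ * mono L₁.g x
    φ₂ x = L₂.κ * mono L₂.g x

    M≢0 : M ≢ 0
    M≢0 = v≢0 e₂ digit₂ ∘ ℕ.m+n≡0⇒n≡0 (μ ℕ.* v e₁)

    exponent≢0 : NonZero (exponent L₁.g L₂.g)
    exponent≢0 = ℕ.≢-nonZero (M≢0 ∘ ℕ.m+n≡0⇒m≡0 M)

    pointwise : ∀ x → ⟪ T₁.indicator , T₂.indicator ⟫ x ≈ 0#
    pointwise x with x ≟ 0#
    -- `M` is positive, so the factor `x ^ M` takes care of 0, about which `vanish` says nothing.
    ... | yes x≈0 = trans (*-congʳ (trans (^-congˡ M x≈0) (0^ M {{ℕ.≢-nonZero M≢0}}))) (zeroˡ _)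
    ... | no  x≉0 = trans (*-congˡ (vanish x x≉0)) (zeroʳ _)

    v-cong : ∀ {f g} → (∀ k → k ℕ.< suc s′ → f k ≡ g k) → v f ≡ v g
    v-cong eq = Digits.∑-cong (suc s′) λ k k<s → cong (ℕ._* suc π ℕ.^ k) (eq k k<s)

    leading-∣ : suc μ ∣ exponent L₁.g L₂.g
    leading-∣ = divides (v e₁ ℕ.+ v e₂) (≡.trans
      (cong₂ (λ y z → M ℕ.+ (y ℕ.+ μ ℕ.* z)) (v-cong (λ k → L₁.g-agree k tt)) (v-cong (λ k → L₂.g-agree k tt)))
      (regroup μ (v e₁) (v e₂)))
      where
      regroup : ∀ μ a b → μ ℕ.* a ℕ.+ b ℕ.+ (a ℕ.+ μ ℕ.* b) ≡ (a ℕ.+ b) ℕ.* suc μ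
      regroup = solve-∀

    rigid : ∀ f h → weight f ℕ.≤ R₁ ℕ.* π → weight h ℕ.≤ R₂ ℕ.* π → suc μ ∣ exponent f h →
      ∀ k → k ℕ.< suc s′ → f k ≡ e₁ k × h k ≡ e₂ k
    rigid f h w w′ = Targets.Rigid.rigid 1≤π T (≡.trans (≡.sym card) N≡2+μ) f h
      (ℕ.≤-trans w (ℕ.≤-reflexive (≡.sym (weight-class d₁ e₁ eq₁ class₁))))
      (ℕ.≤-trans w′ (ℕ.≤-reflexive (≡.sym (weight-class d₂ e₂ eq₂ class₂))))

    others₁ : ∀ f h → Other (const ⊤) (R₁ ℕ.* π) e₁ f → Term (const ⊤) (R₂ ℕ.* π) h → ¬ (suc μ ∣ exponent f h)
    others₁ f h ((_ , w) , k , _ , k<s , ne) (_ , w′) d = ne (proj₁ (rigid f h w w′ d k k<s))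

    others₂ : ∀ f h → Term (const ⊤) (R₁ ℕ.* π) f → Other (const ⊤) (R₂ ℕ.* π) e₂ h → ¬ (suc μ ∣ exponent f h)
    others₂ f h (_ , w) ((_ , w′) , k , _ , k<s , ne) d = ne (proj₂ (rigid f h w w′ d k k<s))

  -- For nonzero `x` the element `α * x ^ μ` is `α / x`. The existence of a suitable `x` is
  -- decidable in a finite field, and its failure makes the product of the indicators vanish off 0.
  common-point : ∃[ x ] ∃[ y ] x * y ≈ α × T₁.trace x ≈ 1# × T₂.trace y ≈ 1#
  common-point with search
    (λ x≈y (x≉0 , t₁ , t₂) → (λ z → x≉0 (trans x≈y z)) , trans (T₁.trace-cong (sym x≈y)) t₁ ,
      trans (T₂.trace-cong (*-congˡ {α} (^-congˡ μ (sym x≈y)))) t₂)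
    (λ x → ¬? (x ≟ 0#) ×-dec (T₁.trace x ≟ 1#) ×-dec (T₂.trace (α * x ^ μ) ≟ 1#))
  ... | yes (x , x≉0 , t₁ , t₂) = x , α * x ^ μ , (begin
    x * (α * x ^ μ)   ≈⟨ x∙yz≈y∙xz x α _ ⟩
    α * x ^ suc μ     ≈⟨ *-congˡ (^-congʳ x pred-N) ⟨
    α * x ^ ℕ.pred N  ≈⟨ *-congˡ (fermat′ x≉0) ⟩
    α * 1#            ≈⟨ *-identityʳ α ⟩
    α                 ∎) , t₁ , t₂
  ... | no none = contradiction vanish indicators-meet
    where
    vanish : ∀ x → x ≉ 0# → T₁.indicator x * T₂.indicator (α * x ^ μ) ≈ 0#
    vanish x x≉0 with T₁.trace x ≟ 1# | T₂.trace (α * x ^ μ) ≟ 1#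
    ... | yes t₁ | yes t₂ = contradiction (x , x≉0 , t₁ , t₂) none
    ... | no ¬t₁ | _      = trans (*-congʳ (T₁.indicator-≈0 x ¬t₁)) (zeroˡ _)
    ... | yes _  | no ¬t₂ = trans (*-congˡ (T₂.indicator-≈0 (α * x ^ μ) ¬t₂)) (zeroʳ _)

-- Choice of the target, and passage from powers of q to powers of p

double : ∀ m → 2 ℕ.+ (m ℕ.+ m) ≡ suc m ℕ.* 2
double = solve-∀

-- If `p − 1` is odd, then `p` is an even prime, hence 2.
target : ∀ {π s′ R₁ d₁ R₂ d₂} → Prime (suc π) → d₁ ℕ.* R₁ ≡ suc s′ → d₂ ℕ.* R₂ ≡ suc s′ →
  2 ℕ.* (R₁ ℕ.+ R₂ ℕ.+ 1) ℕ.≤ suc s′ → Targets.Target π s′ R₁ d₁ R₂ d₂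
target {π} {s′} {R₁} {d₁} {R₂} {d₂} p-prime eq₁ eq₂ room with Targets.halve π
... | h , inj₁ ≡.refl = Targets.odd-target {h} eq₁ eq₂ room
... | m , inj₂ ≡.refl with prime⇒irreducible p-prime (divides (suc m) (double m))
...   | inj₂ 2≡p = subst (λ π → Targets.Target π s′ R₁ d₁ R₂ d₂) (ℕ.suc-injective 2≡p) (Targets.EvenTarget.even-target eq₁ eq₂ room)

x∙yz≡y∙xz : ∀ x y z → x ℕ.* (y ℕ.* z) ≡ y ℕ.* (x ℕ.* z)
x∙yz≡y∙xz = solve-∀

module TraceOne {c ℓ} {π k n} (p-prime : Prime (suc π)) (1≤k : 1 ℕ.≤ k) (F : FiniteField c ℓ ((suc π ℕ.^ k) ℕ.^ n))
  (r₁ r₂ : ℕ) .{{_ : NonZero r₁}} .{{_ : NonZero r₂}} (r₁∣n : r₁ ∣ n) (r₂∣n : r₂ ∣ n)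
  (α : FiniteField.Carrier F) (α≉0 : FiniteField._≉_ F α (FiniteField.0# F))
  (room : 2 ℕ.* (r₁ ℕ.+ r₂ ℕ.+ 1) ℕ.≤ n) where

  open FieldTheory F
  open LinearSets (suc π ℕ.^ k) n F using (Tr)
  private
    instance
      k≢0 : NonZero k
      k≢0 = ℕ.>-nonZero 1≤k
      R₁≢0 : NonZero (k ℕ.* r₁)
      R₁≢0 = ℕ.m*n≢0 k r₁
      R₂≢0 : NonZero (k ℕ.* r₂)
      R₂≢0 = ℕ.m*n≢0 k r₂

    s′ d₁ d₂ : ℕ
    s′ = ℕ.pred (k ℕ.* n)
    d₁ = quotient r₁∣n
    d₂ = quotient r₂∣n

    -- Degrees over the prime field are `k` times those over the field of order `q`, and so is the
    -- number of free positions, of which two are kept.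
    room′ : 2 ℕ.* (k ℕ.* r₁ ℕ.+ k ℕ.* r₂ ℕ.+ 1) ℕ.≤ k ℕ.* n
    room′ = ℕ.≤-trans (ℕ.*-monoʳ-≤ 2 (ℕ.+-monoʳ-≤ (k ℕ.* r₁ ℕ.+ k ℕ.* r₂) 1≤k))
      (ℕ.≤-trans (ℕ.≤-reflexive (regroup k r₁ r₂)) (ℕ.*-monoʳ-≤ k room))
      where
      regroup : ∀ k r₁ r₂ → 2 ℕ.* (k ℕ.* r₁ ℕ.+ k ℕ.* r₂ ℕ.+ k) ≡ k ℕ.* (2 ℕ.* (r₁ ℕ.+ r₂ ℕ.+ 1))
      regroup = solve-∀

    kn≡ : k ℕ.* n ≡ suc s′
    kn≡ = ≡.sym (ℕ.suc-pred (k ℕ.* n) {{ℕ.m*n≢0 k n {{k≢0}} {{ℕ.>-nonZero (ℕ.<-≤-trans 0<bound room)}}}})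
      where
      0<bound : 0 ℕ.< 2 ℕ.* (r₁ ℕ.+ r₂ ℕ.+ 1)
      0<bound = ℕ.≤-trans (ℕ.m≤n+m 1 (r₁ ℕ.+ r₂)) (ℕ.m≤m+n _ _)

    degree : ∀ d r → n ≡ d ℕ.* r → d ℕ.* (k ℕ.* r) ≡ suc s′
    degree d r n≡ = ≡.trans (≡.trans (x∙yz≡y∙xz d k r) (cong (k ℕ.*_) (≡.sym n≡))) kn≡

    degree₁ = degree d₁ r₁ (_∣_.equality r₁∣n)
    degree₂ = degree d₂ r₂ (_∣_.equality r₂∣n)

    card : (suc π ℕ.^ k) ℕ.^ n ≡ suc π ℕ.^ suc s′
    card = ≡.trans (ℕ.^-*-assoc (suc π) k n) (cong (suc π ℕ.^_) kn≡)

    card≥2 : 2 ℕ.≤ (suc π ℕ.^ k) ℕ.^ n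
    card≥2 = ℕ.≤-trans (ℕ.≤-trans (ℕ.nonTrivial⇒n>1 (suc π) {{prime⇒nonTrivial p-prime}})
      (ℕ.m≤m*n (suc π) (suc π ℕ.^ s′) {{ℕ.m^n≢0 (suc π) s′}})) (ℕ.≤-reflexive (≡.sym card))

    open Intersection F p-prime card {d₁ = d₁} {k ℕ.* r₁} {d₂} {k ℕ.* r₂} degree₁ degree₂
      (target {R₁ = k ℕ.* r₁} {d₁} {k ℕ.* r₂} {d₂} p-prime degree₁ degree₂ (ℕ.≤-trans room′ (ℕ.≤-reflexive kn≡)))
      (≡.sym (ℕ.m+[n∸m]≡n card≥2)) α α≉0
    open Expansion F {s = suc s′} p-prime card using (module Trace)

    Tr-trace : ∀ d r .{{_ : NonZero r}} .{{_ : NonZero (k ℕ.* r)}} (n≡ : n ≡ d ℕ.* r) z →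
      Trace.trace d (k ℕ.* r) (degree d r n≡) z ≈ 1# → Tr r z ≈ 1#
    Tr-trace d r n≡ z T≈1 = trans (reflexive (cong (λ m → sum {m} λ i → z ^ ((suc π ℕ.^ k) ℕ.^ (toℕ i ℕ.* r)))
      (≡.trans (cong (_/ r) n≡) (m*n/n≡m d r))))
      (trans (sum-cong-≋ {d} λ i → ^-congʳ z (≡.trans (ℕ.^-*-assoc (suc π) k (toℕ i ℕ.* r))
        (cong (suc π ℕ.^_) (x∙yz≡y∙xz k (toℕ i) r)))) T≈1)

  trace-one-pair : ∃[ x ] ∃[ y ] x * y ≈ α × Tr r₁ x ≈ 1# × Tr r₂ y ≈ 1#
  trace-one-pair with common-point
  ... | x , y , xy≈α , T₁≈1 , T₂≈1 =
    x , y , xy≈α , Tr-trace d₁ r₁ (_∣_.equality r₁∣n) x T₁≈1 , Tr-trace d₂ r₂ (_∣_.equality r₂∣n) y T₂≈1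

-- From a pair with both traces 1 to a common point

module _ {c ℓ} (q n : ℕ) (F : FiniteField c ℓ (q ℕ.^ n)) where
  open FiniteField F
  open ProjectiveLine F
  open LinearSets q n F
  open Relation.Binary.Reasoning.Setoid setoid

  -- The common point is ⟨(x, 1)⟩ = ⟨(α, y)⟩.
  pair⇒point : ∀ r₁ r₂ .{{_ : NonZero r₁}} .{{_ : NonZero r₂}} {α} → α ≉ 0# →
    (∃[ x ] ∃[ y ] x * y ≈ α × Tr r₁ x ≈ 1# × Tr r₂ y ≈ 1#) → Satisfiable (L r₁ ∩ σL α r₂)
  pair⇒point r₁ r₂ {α} α≉0 (x , y , xy≈α , Tx≈1 , Ty≈1) =
    ⟨ x , 1# ⟩[ x≉0 ∘ proj₁ ] ,
    (x , x≉0 , 1# , 1≉0 , sym (*-identityˡ x) , sym (trans (*-identityˡ _) Tx≈1)) ,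
    (y , y≉0 , y⁻¹ , y⁻¹≉0 , sym y⁻¹αTy≈x , sym y⁻¹y≈1)
    where
    x≉0 : x ≉ 0#
    x≉0 x≈0 = α≉0 (trans (sym xy≈α) (trans (*-congʳ x≈0) (zeroˡ y)))

    y≉0 : y ≉ 0#
    y≉0 y≈0 = α≉0 (trans (sym xy≈α) (trans (*-congˡ y≈0) (zeroʳ x)))

    y⁻¹ : Carrier
    y⁻¹ = proj₁ (invertible y y≉0)

    y⁻¹y≈1 : y⁻¹ * y ≈ 1#
    y⁻¹y≈1 = proj₁ (proj₂ (invertible y y≉0))

    y⁻¹≉0 : y⁻¹ ≉ 0#
    y⁻¹≉0 z = 1≉0 (trans (sym y⁻¹y≈1) (trans (*-congʳ z) (zeroˡ y)))

    y⁻¹αTy≈x : y⁻¹ * (α * Tr r₂ y) ≈ x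
    y⁻¹αTy≈x = begin
      y⁻¹ * (α * Tr r₂ y)  ≈⟨ *-congˡ (trans (*-congˡ Ty≈1) (*-identityʳ α)) ⟩
      y⁻¹ * α              ≈⟨ *-congˡ (trans (sym xy≈α) (*-comm x y)) ⟩
      y⁻¹ * (y * x)        ≈⟨ *-assoc _ _ _ ⟨
      y⁻¹ * y * x          ≈⟨ *-congʳ y⁻¹y≈1 ⟩
      1# * x               ≈⟨ *-identityˡ x ⟩
      x                    ∎

open import Data.Nat.Base using (ℕ; NonZero; _+_; _*_; _^_; _≤_; _≥_)
open import Data.Nat.Divisibility.Core using (_∣_)

theorem3p5 : ∀ {c ℓ} (q n : ℕ) → IsPrimePower q → n ≥ 2 →
    (F : FiniteField c ℓ (q ^ n)) →
    (r₁ r₂ : ℕ) .{{_ : NonZero r₁}} .{{_ : NonZero r₂}} →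
    r₁ ∣ n → r₂ ∣ n →
    (α : FiniteField.Carrier F) →
    FiniteField._≉_ F α (FiniteField.0# F) →
    n ≥ 2 * (r₁ + r₂ + 1) →
    Satisfiable (LinearSets.L q n F r₁ ∩ LinearSets.σL q n F α r₂)
theorem3p5 q n (zero  , k , p-prime , _) = contradiction ≡.refl (ℕ.≢-nonZero⁻¹ 0 {{prime⇒nonZero p-prime}})
theorem3p5 q n (suc π , k , p-prime , 1≤k , ≡.refl) _ F r₁ r₂ r₁∣n r₂∣n α α≉0 room =
  pair⇒point q n F r₁ r₂ α≉0 (TraceOne.trace-one-pair p-prime 1≤k F r₁ r₂ r₁∣n r₂∣n α α≉0 room)
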